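{- Let $p$ be a fixed prime and, for a nonzero integer $a$, let $v(a)$ denote the exponent of $p$ in the prime factorization of $a$ (with $v(0)=+\infty$). Let $f,g\in\mathbb{Z}[x]$ be monic polynomials with nonzero resultant $r$. Let $s\ge 0$ be an integer and assume that $p^s$ divides both $f(n)$ and $g(n)$ for all $n\in\mathbb{Z}$. Let $$S=\max_{n\in\mathbb{Z}} v(\gcd(f(n),g(n))).$$ Then $v(r)-S\ge B(s+t)-2B(t)-s$ for all nonnegative integers $t$.
   Context: Define $\alpha(j)=v(j!)=\sum_{i\ge1}\lfloor j/p^i\rfloor$ for integers $j\ge 0$, $\beta(m)=\min\{j\ge 0:\alpha(j)\ge m\}$ for integers $m\ge 0$, and $B(s)=\sum_{m=1}^s\beta(m)$ (so $B(0)=0$). The resultant of $f$ and $g$ is the determinant of their Sylvester matrix (equivalently $\prod_{i,j}(\gamma_i-\delta_j)$ over the roots $\gamma_i$ of $f$ and $\delta_j$ of $g$). -}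

module Defs where

open import Data.Nat as ℕ using (ℕ; zero; suc; _≤ᵇ_; _<ᵇ_; _≡ᵇ_)
open import Data.Nat.DivMod using (_/_)
open import Data.Integer as ℤ using (ℤ; +_; 0ℤ; 1ℤ; -1ℤ)
open import Data.Integer.Divisibility using (_∣_)
open import Data.Fin using (Fin; toℕ; punchIn) renaming (zero to fzero; suc to fsuc)
open import Data.Vec using (Vec; lookup)
open import Data.Bool using (Bool; true; false; if_then_else_; _∧_)
open import Data.Product using (_×_)
open import Relation.Nullary using (¬_)

-- natural-number quotient (divisor 0 gives 0; never used with p prime)
quot : ℕ → ℕ → ℕ
quot a zero = 0
quot a (suc b) = a / suc b

sumFrom1 : ℕ → (ℕ → ℕ) → ℕ
sumFrom1 zero h = 0
sumFrom1 (suc k) h = sumFrom1 k h ℕ.+ h (suc k)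

-- α(j) = Σ_{i≥1} ⌊j/p^i⌋ ; terms with i > j vanish since p^i > j for p ≥ 2
α : ℕ → ℕ → ℕ
α p j = sumFrom1 j (λ i → quot j (p ℕ.^ i))

search : ℕ → (ℕ → Bool) → ℕ
search zero P = 0
search (suc n) P = if P 0 then 0 else suc (search n (λ j → P (suc j)))

-- β(m) = min { j ≥ 0 : α(j) ≥ m }; the minimum is ≤ m·p since α(m·p) ≥ m
β : ℕ → ℕ → ℕ
β p m = search (m ℕ.* p) (λ j → m ≤ᵇ α p j)

B : ℕ → ℕ → ℕ
B p s = sumFrom1 s (β p)

-- Monic integer polynomials:  a monic polynomial of degree d is given by
-- its lower coefficients c₀,…,c_{d-1}:  x^d + c_{d-1} x^{d-1} + … + c₀.

record MonicPoly : Set where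
  constructor monic
  field
    deg   : ℕ
    lower : Vec ℤ deg
open MonicPoly public

coeff : MonicPoly → ℕ → ℤ
coeff (monic d c) k = go d c k
  where
  go : (d : ℕ) → Vec ℤ d → ℕ → ℤ
  go zero _ zero = 1ℤ
  go zero _ (suc k) = 0ℤ
  go (suc d) (a Data.Vec.∷ c) zero = a
  go (suc d) (a Data.Vec.∷ c) (suc k) = go d c k

eval : MonicPoly → ℤ → ℤ
eval f n = go (suc (deg f))
  where
  go : ℕ → ℤ
  go zero = 0ℤ
  go (suc k) = go k ℤ.+ coeff f k ℤ.* (n ℤ.^ k)

sumFin : ∀ n → (Fin n → ℤ) → ℤ
sumFin zero h = 0ℤ
sumFin (suc n) h = h fzero ℤ.+ sumFin n (λ j → h (fsuc j))

det : ∀ n → (Fin n → Fin n → ℤ) → ℤ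
det zero M = 1ℤ
det (suc n) M =
  sumFin (suc n) (λ j → (-1ℤ ℤ.^ toℕ j) ℤ.* M fzero j ℤ.* det n (λ i k → M (fsuc i) (punchIn j k)))

-- Sylvester matrix of f (degree m) and g (degree n): (m+n)×(m+n);
-- row i < n holds the coefficients a_m,…,a_0 of f starting in column i,
-- row n+i (i < m) holds the coefficients b_n,…,b_0 of g starting in column i.
sylvester : (f g : MonicPoly) → Fin (deg f ℕ.+ deg g) → Fin (deg f ℕ.+ deg g) → ℤ
sylvester f g i j = entry (toℕ i) (toℕ j)
  where
  m = deg f
  n = deg g
  band : MonicPoly → ℕ → ℕ → ℕ → ℤ
  band h dh r c = if (r ≤ᵇ c) ∧ ((c ℕ.∸ r) ≤ᵇ dh) then coeff h (dh ℕ.∸ (c ℕ.∸ r)) else 0ℤ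
  entry : ℕ → ℕ → ℤ
  entry r c = if r <ᵇ n then band f m r c else band g n (r ℕ.∸ n) c

resultant : MonicPoly → MonicPoly → ℤ
resultant f g = det (deg f ℕ.+ deg g) (sylvester f g)

-- p-adic valuation:  v(a) = k  iff  p^k ∣ a  and  p^(k+1) ∤ a
-- (for a = 0 no k satisfies this, matching v(0) = +∞)

HasVal : ℕ → ℤ → ℕ → Set
HasVal p a k = (+ (p ℕ.^ k) ∣ a) × ¬ (+ (p ℕ.^ suc k) ∣ a)

{-# OPTIONS --safe #-}
-- Multiply the Sylvester matrix on the left so that its rows become the polynomials u_d g (d < deg f) and
-- u_d f (d < deg g), where u_d = p^(t ∸ α(d)) x(x−1)⋯(x−d+1) takes only values divisible by p^t; this
-- multiplies r by a power of p with exponent at most 2 B(t).  On the right, pass to the coordinates c_l of a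
-- polynomial h in the basis (x−y)(x−y−1)⋯(x−y−l+1), a unitriangular change of basis, where y is a point with
-- p^S ∣ f(y), g(y).  Since l! c_l is the l-th difference of h at y, and p^(s+t) divides all values of every row,
-- p^(s+t ∸ α(l)) divides column l, and column 0 is even divisible by p^(S+t).  The column exponents add up to
-- B(s+t) + S − s as soon as β(s+t) ≤ deg f + deg g.  This holds for t ≤ s, because p^s divides the deg-th
-- difference (deg f)! of f, and likewise for g.  For t ≥ s the bound does not improve when t grows.
module Submission where

open import Defs
open import Data.Nat using (ℕ)
open import Data.Nat.Primality using (Prime)
open import Data.Integer using (ℤ; +_; _-_; _*_; _≥_; 0ℤ)
open import Relation.Binary.PropositionalEquality using (_≢_)
open import Data.Integer.Divisibility using (_∣_)
open import Data.Integer.GCD using (gcd)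
open import Data.Product using (∃; _×_)
open import Data.Nat using (_^_; _≤_) renaming (_+_ to _+ℕ_)

open import Data.Nat as ℕ using (zero; suc; z≤n; s≤s; _∸_; _⊓_; _<_; _!; _≤ᵇ_; _<ᵇ_)
import Data.Nat.Properties as ℕ
open import Data.Nat.Combinatorics using (k![n∸k]!∣n!)
open import Data.Nat.Divisibility as ℕ∣ using (_∣?_) renaming (_∣_ to _∣ₙ_)
open import Data.Nat.DivMod using (_/_; _%_; m≡m%n+[m/n]*n; m%n<n; +-distrib-/-∣ʳ; m*n/n≡m; m<n⇒m/n≡0)
open import Data.Nat.Induction using (<-rec)
open import Data.Nat.Primality using (prime⇒nonZero; prime⇒nonTrivial; euclidsLemma)
open import Data.Nat.Tactic.RingSolver using () renaming (solve-∀ to solveₙ-∀)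
open import Data.Integer as ℤ using (-[1+_]; 1ℤ; -1ℤ; _+_; -_)
import Data.Integer.Properties as ℤ
import Data.Integer.Divisibility.Signed as Signed
open Signed using () renaming (_∣_ to _∣ₛ_)
open import Data.Integer.GCD using (gcd[i,j]∣i; gcd[i,j]∣j)
open import Data.Integer.Tactic.RingSolver using (solve-∀)
open import Data.Bool using (Bool; true; false; T; if_then_else_; _∧_)
open import Data.Empty using (⊥-elim)
open import Data.Fin using (Fin; toℕ; punchIn) renaming (zero to fzero; suc to fsuc)
open import Data.Fin.Properties using (toℕ<n)
open import Data.Product using (_,_; proj₁; proj₂; Σ-syntax)
open import Data.Sum using (_⊎_; inj₁; inj₂)
open import Data.Unit using (tt)
open import Data.Vec using (Vec; []) renaming (_∷_ to _∷ᵥ_)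
open import Data.Vec.Functional using (Vector; _∷_; removeAt)
open import Function using (_∘_)
open import Relation.Binary.PropositionalEquality
  using (_≡_; refl; sym; trans; cong; cong₂; subst; subst₂; module ≡-Reasoning)
open import Relation.Nullary using (¬_; yes; no)

-- Determinants

-- The choice of u_d is the cheapest one. If all values of an integer polynomial of degree d with
-- leading coefficient a are divisible by p^t, then so is its d-th difference d! a; hence p^(t ∸
-- α(d)) is the least power of p that a can contain, and u_d attains it. Both exponent counts rest
-- on one double count: q ∸ α(l) is the number of m with α(l) < m ≤ q, and exactly β(m) indices l
-- satisfy α(l) < m. Summed over all l, q ∸ α(l) therefore gives β(1) + ⋯ + β(q) = B(q), with q = t
-- for each block of rows and q = s + t for the columns. Cutting the sum short can only lower it,
-- which is harmless for the rows, but the columns need all β(s+t) indices; this is where the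
-- condition on deg f + deg g comes from. Column 0 contains the values at y, and S + t in place of s
-- + t there is what brings S into the bound. Since `det` is given by expansion along the first row
-- only, multiplicativity has to be derived from that expansion, and the key is the exchange of the
-- top two rows.

i≡-i⇒i≡0 : ∀ {i} → i ≡ - i → i ≡ 0ℤ
i≡-i⇒i≡0 {+ zero} _ = refl

sumFin-cong : ∀ n (h k : Vector ℤ n) → (∀ i → h i ≡ k i) → sumFin n h ≡ sumFin n k
sumFin-cong zero h k eq = refl
sumFin-cong (suc n) h k eq = cong₂ _+_ (eq fzero) (sumFin-cong n (h ∘ fsuc) (k ∘ fsuc) (eq ∘ fsuc))

sumFin-zero : ∀ n (h : Vector ℤ n) → (∀ i → h i ≡ 0ℤ) → sumFin n h ≡ 0ℤ
sumFin-zero zero h eq = refl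
sumFin-zero (suc n) h eq = cong₂ _+_ (eq fzero) (sumFin-zero n (h ∘ fsuc) (eq ∘ fsuc))

sumFin-+ : ∀ n (h k : Vector ℤ n) → sumFin n (λ i → h i + k i) ≡ sumFin n h + sumFin n k
sumFin-+ zero h k = refl
sumFin-+ (suc n) h k = trans (cong (_+_ (h fzero + k fzero)) (sumFin-+ n (h ∘ fsuc) (k ∘ fsuc)))
  (interchange (h fzero) (k fzero) (sumFin n (h ∘ fsuc)) (sumFin n (k ∘ fsuc)))
  where
  interchange : ∀ a b c d → (a + b) + (c + d) ≡ (a + c) + (b + d)
  interchange = solve-∀

sumFin-*ˡ : ∀ n c (h : Vector ℤ n) → sumFin n (λ i → c * h i) ≡ c * sumFin n h
sumFin-*ˡ zero c h = sym (ℤ.*-zeroʳ c)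
sumFin-*ˡ (suc n) c h = trans (cong (_+_ (c * h fzero)) (sumFin-*ˡ n c (h ∘ fsuc)))
  (sym (ℤ.*-distribˡ-+ c (h fzero) (sumFin n (h ∘ fsuc))))

sign : ∀ {n} → Fin n → ℤ
sign j = -1ℤ ℤ.^ toℕ j

Matrix : ℕ → ℕ → Set
Matrix m n = Fin m → Fin n → ℤ

infixl 7 _·_ _⊗_
_·_ : ∀ {m n} → Vector ℤ m → Matrix m n → Vector ℤ n
_·_ {m} v M l = sumFin m (λ i → v i * M i l)

_⊗_ : ∀ {k m n} → Matrix k m → Matrix m n → Matrix k n
(A ⊗ M) i = A i · M

minor : ∀ {m n} → Matrix m (suc n) → Fin (suc n) → Matrix m n
minor R j i = removeAt (R i) j

laplaceTerm : ∀ n → Vector ℤ (suc n) → Matrix n (suc n) → Vector ℤ (suc n)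
laplaceTerm n u R j = sign j * u j * det n (minor R j)

det-cong : ∀ n (M N : Matrix n n) → (∀ i j → M i j ≡ N i j) → det n M ≡ det n N
det-cong zero M N eq = refl
det-cong (suc n) M N eq = sumFin-cong (suc n) (laplaceTerm n (M fzero) (M ∘ fsuc)) (laplaceTerm n (N fzero) (N ∘ fsuc))
  λ j → cong₂ _*_ (cong (sign j *_) (eq fzero j))
    (det-cong n (minor (M ∘ fsuc) j) (minor (N ∘ fsuc) j) λ i k → eq (fsuc i) (punchIn j k))

det-cong-head : ∀ n (u w : Vector ℤ (suc n)) R → (∀ j → u j ≡ w j) → det (suc n) (u ∷ R) ≡ det (suc n) (w ∷ R)
det-cong-head n u w R eq = sumFin-cong (suc n) (laplaceTerm n u R) (laplaceTerm n w R)
  λ j → cong (λ z → sign j * z * det n (minor R j)) (eq j)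

-- The inductive tool of this part: an operation on the rows below the first is performed in all
-- minors at once and then passes to the larger determinant.
det-cong-minors : ∀ n (u : Vector ℤ (suc n)) R R′ c → (∀ j → det n (minor R j) ≡ c * det n (minor R′ j)) →
  det (suc n) (u ∷ R) ≡ c * det (suc n) (u ∷ R′)
det-cong-minors n u R R′ c eq =
  trans (sumFin-cong (suc n) (laplaceTerm n u R) (λ j → c * laplaceTerm n u R′ j)
    λ j → trans (cong (sign j * u j *_) (eq j)) (pull (sign j * u j) c (det n (minor R′ j))))
  (sumFin-*ˡ (suc n) c (laplaceTerm n u R′))
  where
  pull : ∀ a b c → a * (b * c) ≡ b * (a * c)
  pull = solve-∀

-- Linearity in the first row, phrased with `v · M` because this is the shape of a row of a matrix
-- product.
det-headRow-· : ∀ {m n} (v : Vector ℤ m) (M : Matrix m (suc n)) (R : Matrix n (suc n)) →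
  det (suc n) (v · M ∷ R) ≡ sumFin m (λ i → v i * det (suc n) (M i ∷ R))
det-headRow-· {zero} {n} v M R = sumFin-zero (suc n) (laplaceTerm n (v · M) R)
  λ j → trans (cong (_* det n (minor R j)) (ℤ.*-zeroʳ (sign j))) (ℤ.*-zeroˡ (det n (minor R j)))
det-headRow-· {suc m} {n} v M R = begin
  det (suc n) (v · M ∷ R)
    ≡⟨ sumFin-cong (suc n) (laplaceTerm n (v · M) R) (λ j → v fzero * laplaceTerm n (M fzero) R j + laplaceTerm n rest R j)
         (λ j → expand (sign j) (v fzero) (M fzero j) (rest j) (det n (minor R j))) ⟩
  sumFin (suc n) (λ j → v fzero * laplaceTerm n (M fzero) R j + laplaceTerm n rest R j)
    ≡⟨ sumFin-+ (suc n) (λ j → v fzero * laplaceTerm n (M fzero) R j) (laplaceTerm n rest R) ⟩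
  sumFin (suc n) (λ j → v fzero * laplaceTerm n (M fzero) R j) + det (suc n) (rest ∷ R)
    ≡⟨ cong₂ _+_ (sumFin-*ˡ (suc n) (v fzero) (laplaceTerm n (M fzero) R)) (det-headRow-· (v ∘ fsuc) (M ∘ fsuc) R) ⟩
  sumFin (suc m) (λ i → v i * det (suc n) (M i ∷ R)) ∎
  where
  open ≡-Reasoning
  rest = (v ∘ fsuc) · (M ∘ fsuc)
  expand : ∀ s a b c d → s * (a * b + c) * d ≡ a * (s * b * d) + s * c * d
  expand = solve-∀

-- Two steps of the expansion, along `u` and then `v`. `Φ` stands for the determinant of the
-- remaining rows as a function of the embedding of the surviving columns; keeping it abstract
-- allows an induction on the columns in which no further rows appear.
pairSum : ∀ n (u v : Vector ℤ (suc (suc n))) (Φ : (Fin n → Fin (suc (suc n))) → ℤ) → ℤ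
pairSum n u v Φ = sumFin (suc (suc n)) λ j → sign j * u j *
  sumFin (suc n) λ k → sign k * v (punchIn j k) * Φ (λ l → punchIn j (punchIn k l))

innerPairSum : ∀ n (u v : Vector ℤ (suc (suc n))) (Φ : (Fin n → Fin (suc (suc n))) → ℤ) → ℤ
innerPairSum n u v Φ = sumFin (suc n) λ j → sign j * u (fsuc j) *
  sumFin n λ k → sign k * v (fsuc (punchIn j k)) * Φ (λ l → punchIn (fsuc j) (punchIn (fsuc k) l))

crossSum : ∀ n (u : Vector ℤ (suc (suc n))) (Φ : (Fin n → Fin (suc (suc n))) → ℤ) → ℤ
crossSum n u Φ = sumFin (suc n) λ k → sign k * u (fsuc k) * Φ (λ l → fsuc (punchIn k l))

-- Sorts the pairs of columns by what happens in column 0. If `v` takes it, the column chosen for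
-- `u` is shifted by one and brings a minus sign; if neither takes it, both choices are shifted and
-- the two signs cancel.
pairSum-split : ∀ n u v Φ →
  pairSum n u v Φ ≡ (u fzero * crossSum n v Φ + - v fzero * crossSum n u Φ) + innerPairSum n u v Φ
pairSum-split n u v Φ = begin
  1ℤ * u fzero * crossSum n v Φ + sumFin (suc n) mixed
    ≡⟨ cong (_+_ (1ℤ * u fzero * crossSum n v Φ)) (sumFin-cong (suc n) mixed (λ j → - v fzero * cross j + inner j) λ j →
         trans (cong (λ z → -1ℤ * sign j * u (fsuc j) * (1ℤ * v fzero * X j + z)) (negate j))
               (regroup (sign j) (u (fsuc j)) (v fzero) (X j) (sumFin n (Z j)))) ⟩
  1ℤ * u fzero * crossSum n v Φ + sumFin (suc n) (λ j → - v fzero * cross j + inner j)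
    ≡⟨ cong (_+_ (1ℤ * u fzero * crossSum n v Φ)) (trans (sumFin-+ (suc n) (λ j → - v fzero * cross j) inner)
         (cong (_+ innerPairSum n u v Φ) (sumFin-*ˡ (suc n) (- v fzero) cross))) ⟩
  1ℤ * u fzero * crossSum n v Φ + (- v fzero * crossSum n u Φ + innerPairSum n u v Φ)
    ≡⟨ reassoc (u fzero) (crossSum n v Φ) (- v fzero * crossSum n u Φ) (innerPairSum n u v Φ) ⟩
  (u fzero * crossSum n v Φ + - v fzero * crossSum n u Φ) + innerPairSum n u v Φ ∎
  where
  open ≡-Reasoning
  X = λ j → Φ (λ l → fsuc (punchIn j l))
  Y Z : Fin (suc n) → Fin n → ℤ
  Y j k = -1ℤ * sign k * v (fsuc (punchIn j k)) * Φ (λ l → punchIn (fsuc j) (punchIn (fsuc k) l))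
  Z j k = sign k * v (fsuc (punchIn j k)) * Φ (λ l → punchIn (fsuc j) (punchIn (fsuc k) l))
  mixed cross inner : Fin (suc n) → ℤ
  mixed j = -1ℤ * sign j * u (fsuc j) * (1ℤ * v fzero * X j + sumFin n (Y j))
  cross j = sign j * u (fsuc j) * X j
  inner j = sign j * u (fsuc j) * sumFin n (Z j)
  assoc₃ : ∀ a b c → -1ℤ * a * b * c ≡ -1ℤ * (a * b * c)
  assoc₃ = solve-∀
  negate : ∀ j → sumFin n (Y j) ≡ -1ℤ * sumFin n (Z j)
  negate j = trans
    (sumFin-cong n (Y j) (λ k → -1ℤ * Z j k)
      λ k → assoc₃ (sign k) (v (fsuc (punchIn j k))) (Φ (λ l → punchIn (fsuc j) (punchIn (fsuc k) l))))
    (sumFin-*ˡ n -1ℤ (Z j))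
  regroup : ∀ s a b x z → -1ℤ * s * a * (1ℤ * b * x + -1ℤ * z) ≡ - b * (s * a * x) + s * a * z
  regroup = solve-∀
  reassoc : ∀ a b c d → 1ℤ * a * b + (c + d) ≡ (a * b + c) + d
  reassoc = solve-∀

mutual
  -- Exchanging `u` and `v` swaps the two cross terms of the split up to sign, and the inner sum is
  -- a pair sum with one column fewer. The condition on `Φ` takes the place of function
  -- extensionality.
  pairSum-antisym : ∀ n u v Φ → (∀ {σ τ} → (∀ l → σ l ≡ τ l) → Φ σ ≡ Φ τ) →
    pairSum n u v Φ ≡ - pairSum n v u Φ
  pairSum-antisym n u v Φ ext = begin
    pairSum n u v Φ
      ≡⟨ pairSum-split n u v Φ ⟩
    (u fzero * crossSum n v Φ + - v fzero * crossSum n u Φ) + innerPairSum n u v Φ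
      ≡⟨ cong (_+_ (u fzero * crossSum n v Φ + - v fzero * crossSum n u Φ)) (innerPairSum-antisym n u v Φ ext) ⟩
    (u fzero * crossSum n v Φ + - v fzero * crossSum n u Φ) + - innerPairSum n v u Φ
      ≡⟨ flip (u fzero) (v fzero) (crossSum n v Φ) (crossSum n u Φ) (innerPairSum n v u Φ) ⟩
    - ((v fzero * crossSum n u Φ + - u fzero * crossSum n v Φ) + innerPairSum n v u Φ)
      ≡⟨ cong -_ (pairSum-split n v u Φ) ⟨
    - pairSum n v u Φ ∎
    where
    open ≡-Reasoning
    flip : ∀ a b c d e → (a * c + - b * d) + - e ≡ - ((b * d + - a * c) + e)
    flip = solve-∀

  innerPairSum-antisym : ∀ n u v Φ → (∀ {σ τ} → (∀ l → σ l ≡ τ l) → Φ σ ≡ Φ τ) →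
    innerPairSum n u v Φ ≡ - innerPairSum n v u Φ
  innerPairSum-antisym zero u v Φ ext = trans (vanish u) (cong -_ (sym (vanish v)))
    where
    vanish : ∀ w → sumFin 1 (λ j → sign j * w (fsuc j) * 0ℤ) ≡ 0ℤ
    vanish w = sumFin-zero 1 (λ j → sign j * w (fsuc j) * 0ℤ) λ j → ℤ.*-zeroʳ (sign j * w (fsuc j))
  innerPairSum-antisym (suc n) u v Φ ext =
    trans (asPairSum u v) (trans (pairSum-antisym n (u ∘ fsuc) (v ∘ fsuc) (Φ ∘ lift) λ eq → ext (lift-cong eq))
      (cong -_ (sym (asPairSum v u))))
    where
    -- Neither chosen column is column 0, so column 0 survives in first place and the other
    -- surviving columns are shifted by one.
    lift : (Fin n → Fin (suc (suc n))) → Fin (suc n) → Fin (suc (suc (suc n)))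
    lift σ = fzero ∷ (fsuc ∘ σ)
    lift-cong : ∀ {σ τ} → (∀ l → σ l ≡ τ l) → ∀ l → lift σ l ≡ lift τ l
    lift-cong eq fzero = refl
    lift-cong eq (fsuc l) = cong fsuc (eq l)
    shift : ∀ j k l → punchIn (fsuc j) (punchIn (fsuc k) l) ≡ lift (λ l → punchIn j (punchIn k l)) l
    shift j k fzero = refl
    shift j k (fsuc l) = refl
    asPairSum : ∀ u v → innerPairSum (suc n) u v Φ ≡ pairSum n (u ∘ fsuc) (v ∘ fsuc) (Φ ∘ lift)
    asPairSum u v = sumFin-cong (suc (suc n))
      (λ j → sign j * u (fsuc j) * sumFin (suc n) (λ k → weight j k * Φ (λ l → punchIn (fsuc j) (punchIn (fsuc k) l))))
      (λ j → sign j * u (fsuc j) * sumFin (suc n) (λ k → weight j k * Φ (lift (λ l → punchIn j (punchIn k l)))))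
      λ j → cong (sign j * u (fsuc j) *_) (sumFin-cong (suc n)
        (λ k → weight j k * Φ (λ l → punchIn (fsuc j) (punchIn (fsuc k) l)))
        (λ k → weight j k * Φ (lift (λ l → punchIn j (punchIn k l))))
        λ k → cong (weight j k *_) (ext (shift j k)))
      where
      weight : Fin (suc (suc n)) → Fin (suc n) → ℤ
      weight j k = sign k * v (fsuc (punchIn j k))

-- A minor of a minor reads column `punchIn j (punchIn k l)`, so the determinant is a `pairSum` by
-- unfolding.
det-swap : ∀ {n} (u v : Vector ℤ (suc (suc n))) (R : Matrix n (suc (suc n))) →
  det (suc (suc n)) (u ∷ v ∷ R) ≡ - det (suc (suc n)) (v ∷ u ∷ R)
det-swap {n} u v R = pairSum-antisym n u v (λ σ → det n (λ i l → R i (σ l)))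
  λ {σ} {τ} eq → det-cong n (λ i l → R i (σ l)) (λ i l → R i (τ l)) λ i l → cong (R i) (eq l)

det-repeat : ∀ {n} (u : Vector ℤ (suc (suc n))) (R : Matrix n (suc (suc n))) →
  det (suc (suc n)) (u ∷ u ∷ R) ≡ 0ℤ
det-repeat u R = i≡-i⇒i≡0 (det-swap u u R)

-- Only the top two rows can be exchanged directly. Row `fsuc j` is brought to second place inside
-- the minors along row 0, which yields `sign j`, and one exchange with row 0 adds the last sign.
det-moveRow : ∀ {n} (M : Matrix (suc n) (suc n)) j → det (suc n) (M j ∷ removeAt M j) ≡ sign j * det (suc n) M
det-moveRow {n} M fzero = sym (ℤ.*-identityˡ (det (suc n) M))
det-moveRow {suc n} M (fsuc j) = begin
  det (suc (suc n)) (M (fsuc j) ∷ removeAt M (fsuc j))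
    ≡⟨ det-cong (suc (suc n)) (M (fsuc j) ∷ removeAt M (fsuc j)) (M (fsuc j) ∷ M fzero ∷ R)
         (λ { fzero _ → refl ; (fsuc fzero) _ → refl ; (fsuc (fsuc _)) _ → refl }) ⟩
  det (suc (suc n)) (M (fsuc j) ∷ M fzero ∷ R)
    ≡⟨ det-swap (M (fsuc j)) (M fzero) R ⟩
  - det (suc (suc n)) (M fzero ∷ M (fsuc j) ∷ R)
    ≡⟨ cong -_ (det-cong-minors (suc n) (M fzero) (M (fsuc j) ∷ R) (M ∘ fsuc) (sign j) inner) ⟩
  - (sign j * det (suc (suc n)) M)
    ≡⟨ neg (sign j) (det (suc (suc n)) M) ⟩
  -1ℤ * sign j * det (suc (suc n)) M ∎
  where
  open ≡-Reasoning
  R : Matrix n (suc (suc n))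
  R i = M (fsuc (punchIn j i))
  inner : ∀ k → det (suc n) (minor (M (fsuc j) ∷ R) k) ≡ sign j * det (suc n) (minor (M ∘ fsuc) k)
  inner k = trans
    (det-cong (suc n) (minor (M (fsuc j) ∷ R) k) (minor (M ∘ fsuc) k j ∷ removeAt (minor (M ∘ fsuc) k) j)
      λ { fzero _ → refl ; (fsuc _) _ → refl })
    (det-moveRow (minor (M ∘ fsuc) k) j)
  neg : ∀ a b → - (a * b) ≡ -1ℤ * a * b
  neg = solve-∀

-- After an exchange, `u` heads every minor along the second row, so induction clears the rows below
-- it. Linearity then splits the row now on top; its multiple of `u` repeats a row and vanishes, and
-- a second exchange restores the order.
det-addHeadRow : ∀ {n} (u : Vector ℤ (suc n)) (c : Vector ℤ n) (R : Matrix n (suc n)) →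
  det (suc n) (u ∷ λ i j → c i * u j + R i j) ≡ det (suc n) (u ∷ R)
det-addHeadRow {zero} u c R = refl
det-addHeadRow {suc n} u c R = begin
  det (suc (suc n)) (u ∷ λ i j → c i * u j + R i j)
    ≡⟨ det-cong (suc (suc n)) (u ∷ λ i j → c i * u j + R i j) (u ∷ w ∷ R′)
         (λ { fzero _ → refl ; (fsuc fzero) _ → refl ; (fsuc (fsuc _)) _ → refl }) ⟩
  det (suc (suc n)) (u ∷ w ∷ R′)
    ≡⟨ det-swap u w R′ ⟩
  - det (suc (suc n)) (w ∷ u ∷ R′)
    ≡⟨ cong -_ (det-cong-minors (suc n) w (u ∷ R′) (u ∷ R ∘ fsuc) 1ℤ inner) ⟩
  - (1ℤ * det (suc (suc n)) (w ∷ u ∷ R ∘ fsuc))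
    ≡⟨ cong (λ z → - (1ℤ * z)) (det-cong-head (suc n) w (coeffs · rows) (u ∷ R ∘ fsuc)
         λ k → combine (c fzero) (u k) (R fzero k)) ⟩
  - (1ℤ * det (suc (suc n)) (coeffs · rows ∷ u ∷ R ∘ fsuc))
    ≡⟨ cong (λ z → - (1ℤ * z)) (det-headRow-· coeffs rows (u ∷ R ∘ fsuc)) ⟩
  - (1ℤ * (c fzero * det (suc (suc n)) (u ∷ u ∷ R ∘ fsuc) + (1ℤ * swapped + 0ℤ)))
    ≡⟨ cong (λ z → - (1ℤ * (c fzero * z + (1ℤ * swapped + 0ℤ)))) (det-repeat u (R ∘ fsuc)) ⟩
  - (1ℤ * (c fzero * 0ℤ + (1ℤ * swapped + 0ℤ)))
    ≡⟨ simplify (c fzero) swapped ⟩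
  - swapped
    ≡⟨ det-swap u (R fzero) (R ∘ fsuc) ⟨
  det (suc (suc n)) (u ∷ R fzero ∷ R ∘ fsuc)
    ≡⟨ det-cong (suc (suc n)) (u ∷ R fzero ∷ R ∘ fsuc) (u ∷ R)
         (λ { fzero _ → refl ; (fsuc fzero) _ → refl ; (fsuc (fsuc _)) _ → refl }) ⟩
  det (suc (suc n)) (u ∷ R) ∎
  where
  open ≡-Reasoning
  w : Vector ℤ (suc (suc n))
  w j = c fzero * u j + R fzero j
  R′ : Matrix n (suc (suc n))
  R′ i j = c (fsuc i) * u j + R (fsuc i) j
  coeffs : Vector ℤ 2
  coeffs = c fzero ∷ 1ℤ ∷ λ ()
  rows : Matrix 2 (suc (suc n))
  rows = u ∷ R fzero ∷ λ ()
  swapped = det (suc (suc n)) (R fzero ∷ u ∷ R ∘ fsuc)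
  inner : ∀ k → det (suc n) (minor (u ∷ R′) k) ≡ 1ℤ * det (suc n) (minor (u ∷ R ∘ fsuc) k)
  inner k = begin
    det (suc n) (minor (u ∷ R′) k)
      ≡⟨ det-cong (suc n) (minor (u ∷ R′) k) (removeAt u k ∷ λ i j → c (fsuc i) * removeAt u k j + minor (R ∘ fsuc) k i j)
           (λ { fzero _ → refl ; (fsuc _) _ → refl }) ⟩
    det (suc n) (removeAt u k ∷ λ i j → c (fsuc i) * removeAt u k j + minor (R ∘ fsuc) k i j)
      ≡⟨ det-addHeadRow (removeAt u k) (c ∘ fsuc) (minor (R ∘ fsuc) k) ⟩
    det (suc n) (removeAt u k ∷ minor (R ∘ fsuc) k)
      ≡⟨ det-cong (suc n) (removeAt u k ∷ minor (R ∘ fsuc) k) (minor (u ∷ R ∘ fsuc) k)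
           (λ { fzero _ → refl ; (fsuc _) _ → refl }) ⟩
    det (suc n) (minor (u ∷ R ∘ fsuc) k)
      ≡⟨ ℤ.*-identityˡ (det (suc n) (minor (u ∷ R ∘ fsuc) k)) ⟨
    1ℤ * det (suc n) (minor (u ∷ R ∘ fsuc) k) ∎
  combine : ∀ a b r → a * b + r ≡ a * b + (1ℤ * r + 0ℤ)
  combine = solve-∀
  simplify : ∀ a d → - (1ℤ * (a * 0ℤ + (1ℤ * d + 0ℤ))) ≡ - d
  simplify = solve-∀

sumFin-removeAt : ∀ n (h : Fin (suc n) → ℤ) j → sumFin (suc n) h ≡ h j + sumFin n (removeAt h j)
sumFin-removeAt n h fzero = refl
sumFin-removeAt (suc n) h (fsuc j) =
  trans (cong (_+_ (h fzero)) (sumFin-removeAt n (h ∘ fsuc) j))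
    (swap (h fzero) (h (fsuc j)) (sumFin n (removeAt (h ∘ fsuc) j)))
  where
  swap : ∀ a b c → a + (b + c) ≡ b + (a + c)
  swap = solve-∀

-- The first row of the product is a combination of the rows of `N`. With row `N j` on top, its
-- multiples can be removed from the rows below, and what remains there is the product of two
-- matrices with column `j` and row `j` deleted.
det-⊗ : ∀ n (M N : Matrix n n) → det n (M ⊗ N) ≡ det n M * det n N
det-⊗ zero M N = refl
det-⊗ (suc n) M N = begin
  det (suc n) (M fzero · N ∷ M′ ⊗ N)
    ≡⟨ det-headRow-· (M fzero) N (M′ ⊗ N) ⟩
  sumFin (suc n) (λ j → M fzero j * det (suc n) (N j ∷ M′ ⊗ N))
    ≡⟨ sumFin-cong (suc n) (λ j → M fzero j * det (suc n) (N j ∷ M′ ⊗ N))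
         (λ j → det (suc n) N * laplaceTerm n (M fzero) M′ j)
         (λ j → trans (cong (M fzero j *_) (term j)) (regroup (M fzero j) (det n (minor M′ j)) (sign j) (det (suc n) N))) ⟩
  sumFin (suc n) (λ j → det (suc n) N * laplaceTerm n (M fzero) M′ j)
    ≡⟨ sumFin-*ˡ (suc n) (det (suc n) N) (laplaceTerm n (M fzero) M′) ⟩
  det (suc n) N * det (suc n) M
    ≡⟨ ℤ.*-comm (det (suc n) N) (det (suc n) M) ⟩
  det (suc n) M * det (suc n) N ∎
  where
  open ≡-Reasoning
  M′ : Matrix n (suc n)
  M′ = M ∘ fsuc
  regroup : ∀ m d s e → m * (d * (s * e)) ≡ e * (s * m * d)
  regroup = solve-∀
  term : ∀ j → det (suc n) (N j ∷ M′ ⊗ N) ≡ det n (minor M′ j) * (sign j * det (suc n) N)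
  term j = begin
    det (suc n) (N j ∷ M′ ⊗ N)
      ≡⟨ det-cong (suc n) (N j ∷ M′ ⊗ N) (N j ∷ λ i k → M′ i j * N j k + (minor M′ j ⊗ removeAt N j) i k)
           (λ { fzero _ → refl ; (fsuc i) k → sumFin-removeAt n (λ l → M′ i l * N l k) j }) ⟩
    det (suc n) (N j ∷ λ i k → M′ i j * N j k + (minor M′ j ⊗ removeAt N j) i k)
      ≡⟨ det-addHeadRow (N j) (λ i → M′ i j) (minor M′ j ⊗ removeAt N j) ⟩
    det (suc n) (N j ∷ minor M′ j ⊗ removeAt N j)
      ≡⟨ det-cong-minors n (N j) (minor M′ j ⊗ removeAt N j) (removeAt N j) (det n (minor M′ j))
           (λ k → det-⊗ n (minor M′ j) (minor (removeAt N j) k)) ⟩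
    det n (minor M′ j) * det (suc n) (N j ∷ removeAt N j)
      ≡⟨ cong (det n (minor M′ j) *_) (det-moveRow N j) ⟩
    det n (minor M′ j) * (sign j * det (suc n) N) ∎

prodFin : ∀ n → Vector ℤ n → ℤ
prodFin zero d = 1ℤ
prodFin (suc n) d = d fzero * prodFin n (d ∘ fsuc)

det-zeroColumn : ∀ n (M : Matrix (suc n) (suc n)) → (∀ i → M i fzero ≡ 0ℤ) → det (suc n) M ≡ 0ℤ
det-zeroColumn n M eq = sumFin-zero (suc n) (laplaceTerm n (M fzero) (M ∘ fsuc)) (term n M eq)
  where
  term : ∀ n (M : Matrix (suc n) (suc n)) → (∀ i → M i fzero ≡ 0ℤ) →
    ∀ j → laplaceTerm n (M fzero) (M ∘ fsuc) j ≡ 0ℤ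
  term n M eq fzero = cong (λ z → 1ℤ * z * det n (minor (M ∘ fsuc) fzero)) (eq fzero)
  term (suc n) M eq (fsuc j) =
    trans (cong (sign (fsuc j) * M fzero (fsuc j) *_) (det-zeroColumn n (minor (M ∘ fsuc) (fsuc j)) (eq ∘ fsuc)))
      (ℤ.*-zeroʳ (sign (fsuc j) * M fzero (fsuc j)))

det-upperTriangular : ∀ n (M : Matrix n n) → (∀ i j → toℕ j ℕ.< toℕ i → M i j ≡ 0ℤ) →
  det n M ≡ prodFin n (λ i → M i i)
det-upperTriangular zero M upper = refl
det-upperTriangular (suc n) M upper = begin
  1ℤ * M fzero fzero * det n (minor (M ∘ fsuc) fzero) + sumFin n (laplaceTerm n (M fzero) (M ∘ fsuc) ∘ fsuc)
    ≡⟨ cong₂ _+_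
         (cong₂ _*_ (ℤ.*-identityˡ (M fzero fzero))
           (det-upperTriangular n (minor (M ∘ fsuc) fzero) λ i j j<i → upper (fsuc i) (fsuc j) (s≤s j<i)))
         (sumFin-zero n (laplaceTerm n (M fzero) (M ∘ fsuc) ∘ fsuc)
           (λ j → trans (cong (sign (fsuc j) * M fzero (fsuc j) *_) (vanish n M upper j))
             (ℤ.*-zeroʳ (sign (fsuc j) * M fzero (fsuc j))))) ⟩
  M fzero fzero * prodFin n (λ i → M (fsuc i) (fsuc i)) + 0ℤ
    ≡⟨ ℤ.+-identityʳ (prodFin (suc n) (λ i → M i i)) ⟩
  prodFin (suc n) (λ i → M i i) ∎
  where
  open ≡-Reasoning
  vanish : ∀ n (M : Matrix (suc n) (suc n)) → (∀ i j → toℕ j ℕ.< toℕ i → M i j ≡ 0ℤ) →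
    ∀ j → det n (minor (M ∘ fsuc) (fsuc j)) ≡ 0ℤ
  vanish (suc n) M upper j = det-zeroColumn n (minor (M ∘ fsuc) (fsuc j)) λ i → upper (fsuc i) fzero (s≤s z≤n)

sumFin-∣ : ∀ n {d} (h : Vector ℤ n) → (∀ i → d ∣ₛ h i) → d ∣ₛ sumFin n h
sumFin-∣ zero h div = Signed.divides 0ℤ refl
sumFin-∣ (suc n) h div = Signed.∣m∣n⇒∣m+n (div fzero) (sumFin-∣ n (h ∘ fsuc) (div ∘ fsuc))

prodFin-removeAt : ∀ n (d : Vector ℤ (suc n)) j → prodFin (suc n) d ≡ d j * prodFin n (removeAt d j)
prodFin-removeAt n d fzero = refl
prodFin-removeAt (suc n) d (fsuc j) =
  trans (cong (d fzero *_) (prodFin-removeAt n (d ∘ fsuc) j))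
    (swap (d fzero) (d (fsuc j)) (prodFin n (removeAt (d ∘ fsuc) j)))
  where
  swap : ∀ a b c → a * (b * c) ≡ b * (a * c)
  swap = solve-∀

*-pres-∣ₛ : ∀ {a b c d} → a ∣ₛ b → c ∣ₛ d → a * c ∣ₛ b * d
*-pres-∣ₛ {a} {b} {c} {d} a∣b c∣d = Signed.∣-trans (Signed.*-monoʳ-∣ a c∣d) (Signed.*-monoˡ-∣ d a∣b)

-- Each term of the full expansion takes one entry from every column; expanding along row 0 uses up
-- column `l` together with its divisor.
prodFin-∣-det : ∀ n (d : Vector ℤ n) (M : Matrix n n) → (∀ i l → d l ∣ₛ M i l) → prodFin n d ∣ₛ det n M
prodFin-∣-det zero d M div = Signed.∣-refl
prodFin-∣-det (suc n) d M div = sumFin-∣ (suc n) (laplaceTerm n (M fzero) (M ∘ fsuc)) λ l →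
  subst (_∣ₛ sign l * M fzero l * det n (minor (M ∘ fsuc) l)) (sym (prodFin-removeAt n d l))
    (*-pres-∣ₛ (Signed.∣n⇒∣m*n (sign l) (div fzero l))
      (prodFin-∣-det n (removeAt d l) (minor (M ∘ fsuc) l) λ i k → div (fsuc i) (punchIn l k)))

-- The functions α, β and B

remainder-quotient : ∀ r c q .{{_ : ℕ.NonZero q}} → r < q → (r ℕ.+ c ℕ.* q) / q ≡ c
remainder-quotient r c q r<q =
  trans (+-distrib-/-∣ʳ r (ℕ∣.divides c refl)) (cong₂ ℕ._+_ (m<n⇒m/n≡0 r<q) (m*n/n≡m c q))

quot-suc-∣ : ∀ j q .{{_ : ℕ.NonZero q}} → q ∣ₙ suc j → quot (suc j) q ≡ suc (quot j q)
quot-suc-∣ j q@(suc q′) (ℕ∣.divides (suc c) eq) = begin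
  suc j / q                       ≡⟨ cong (_/ q) eq ⟩
  suc c ℕ.* q / q                 ≡⟨ m*n/n≡m (suc c) q ⟩
  suc c                           ≡⟨ cong suc (remainder-quotient q′ c q (ℕ.n<1+n q′)) ⟨
  suc ((q′ ℕ.+ c ℕ.* q) / q)      ≡⟨ cong (λ z → suc (z / q)) (ℕ.suc-injective eq) ⟨
  suc (j / q)                     ∎
  where open ≡-Reasoning

quot-suc-∤ : ∀ j q .{{_ : ℕ.NonZero q}} → ¬ (q ∣ₙ suc j) → quot (suc j) q ≡ quot j q
quot-suc-∤ j q@(suc q′) q∤1+j =
  trans (cong (λ z → suc z / q) (m≡m%n+[m/n]*n j q)) (remainder-quotient (suc (j % q)) (j / q) q 1+r<q)
  where
  1+r<q : suc (j % q) < q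
  1+r<q = ℕ.≤∧≢⇒< (m%n<n j q) λ 1+r≡q →
    q∤1+j (ℕ∣.divides (suc (j / q)) (trans (cong suc (m≡m%n+[m/n]*n j q)) (cong (ℕ._+ j / q ℕ.* q) 1+r≡q)))

search-below : ∀ n (P : ℕ → Bool) j → j < search n P → P j ≡ false
search-below (suc n) P j j<s with P 0 in eq
search-below (suc n) P zero j<s | false = eq
search-below (suc n) P (suc j) (s≤s j<s) | false = search-below n (P ∘ suc) j j<s

-- If all arguments below `n` fail, the search returns `n` without testing it; the hypothesis covers
-- this default.
search-hit : ∀ n (P : ℕ → Bool) → P n ≡ true → P (search n P) ≡ true
search-hit zero P hit = hit
search-hit (suc n) P hit with P 0 in eq
... | true = eq
... | false = search-hit n (P ∘ suc) hit

sumBelowℕ : ℕ → (ℕ → ℕ) → ℕ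
sumBelowℕ zero h = 0
sumBelowℕ (suc n) h = sumBelowℕ n h ℕ.+ h n

module _ {p : ℕ} (pp : Prime p) where
  private instance
    p≢0 = prime⇒nonZero pp
    p≢1 = prime⇒nonTrivial pp

  p^_≢0 : ∀ k → ℕ.NonZero (p ^ k)
  p^ k ≢0 = ℕ.m^n≢0 p k

  k<p^k : ∀ k → k < p ^ k
  k<p^k zero = s≤s z≤n
  k<p^k (suc k) = begin-strict
    suc k             ≤⟨ k<p^k k ⟩
    p ^ k             <⟨ ℕ.^-monoʳ-< p (ℕ.nonTrivial⇒n>1 p) (ℕ.n<1+n k) ⟩
    p ^ suc k         ∎
    where open ℕ.≤-Reasoning

  p^∣p^ : ∀ {a b} → a ≤ b → p ^ a ∣ₙ p ^ b
  p^∣p^ {a} {b} a≤b = ℕ∣.divides (p ^ (b ∸ a)) (begin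
    p ^ b                        ≡⟨ cong (p ^_) (ℕ.m∸n+n≡m a≤b) ⟨
    p ^ (b ∸ a ℕ.+ a)            ≡⟨ ℕ.^-distribˡ-+-* p (b ∸ a) a ⟩
    p ^ (b ∸ a) ℕ.* p ^ a        ∎)
    where open ≡-Reasoning

  p^-cancel : ∀ {a b u} → ¬ (p ∣ₙ u) → p ^ b ∣ₙ p ^ a ℕ.* u → b ≤ a
  p^-cancel {a} {b} {u} p∤u div with b ℕ.≤? a
  ... | yes b≤a = b≤a
  ... | no b≰a = ⊥-elim (p∤u (ℕ∣.*-cancelˡ-∣ (p ^ a) {{p^ a ≢0}}
    (subst (_∣ₙ p ^ a ℕ.* u) (ℕ.*-comm p (p ^ a)) (ℕ∣.∣-trans (p^∣p^ (ℕ.≰⇒> b≰a)) div))))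

  p-part : ∀ n → .{{ℕ.NonZero n}} → Σ[ a ∈ ℕ ] Σ[ u ∈ ℕ ] (n ≡ p ^ a ℕ.* u × ¬ (p ∣ₙ u))
  p-part = <-rec (λ n → .{{ℕ.NonZero n}} → Σ[ a ∈ ℕ ] Σ[ u ∈ ℕ ] (n ≡ p ^ a ℕ.* u × ¬ (p ∣ₙ u))) step
    where
    step : ∀ n → (∀ {m} → m < n → .{{ℕ.NonZero m}} → Σ[ a ∈ ℕ ] Σ[ u ∈ ℕ ] (m ≡ p ^ a ℕ.* u × ¬ (p ∣ₙ u))) →
      .{{ℕ.NonZero n}} → Σ[ a ∈ ℕ ] Σ[ u ∈ ℕ ] (n ≡ p ^ a ℕ.* u × ¬ (p ∣ₙ u))
    step n rec with p ∣? n
    ... | no p∤n = 0 , n , sym (ℕ.*-identityˡ n) , p∤n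
    ... | yes (ℕ∣.divides m@(suc _) refl) with rec (ℕ.m<m*n m p (ℕ.nonTrivial⇒n>1 p))
    ...   | a , u , eq , p∤u = suc a , u , trans (cong (ℕ._* p) eq) (rearrange (p ^ a) u p) , p∤u
      where
      rearrange : ∀ a u p → a ℕ.* u ℕ.* p ≡ p ℕ.* a ℕ.* u
      rearrange = solveₙ-∀

  -- Passing from j to j + 1 raises the quotient by p^i by one exactly when p^i divides j + 1, that
  -- is for 1 ≤ i ≤ a. The range of summation also grows by one index, but that quotient of j is
  -- zero because p^(j+1) > j.
  α-suc : ∀ j a u → suc j ≡ p ^ a ℕ.* u → ¬ (p ∣ₙ u) → α p (suc j) ≡ α p j ℕ.+ a
  α-suc j a u 1+j≡ p∤u = begin
    α p (suc j)
      ≡⟨ partial (suc j) ⟩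
    α p j ℕ.+ quot j (p ^ suc j) ℕ.+ (suc j ⊓ a)
      ≡⟨ cong₂ (λ x y → α p j ℕ.+ x ℕ.+ y)
           (quot-small (p ^ suc j) (ℕ.<-trans (ℕ.n<1+n j) (k<p^k (suc j)))) (ℕ.m≥n⇒m⊓n≡n a≤1+j) ⟩
    α p j ℕ.+ 0 ℕ.+ a
      ≡⟨ cong (ℕ._+ a) (ℕ.+-identityʳ (α p j)) ⟩
    α p j ℕ.+ a ∎
    where
    open ≡-Reasoning
    quot-small : ∀ q → j < q → quot j q ≡ 0
    quot-small (suc q) j<q = m<n⇒m/n≡0 j<q
    a≤1+j : a ≤ suc j
    a≤1+j = ℕ.≤-trans (ℕ.<⇒≤ (k<p^k a)) (ℕ∣.∣⇒≤ (ℕ∣.divides u (trans 1+j≡ (ℕ.*-comm (p ^ a) u))))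
    rearrange : ∀ x y z → x ℕ.+ y ℕ.+ suc z ≡ x ℕ.+ z ℕ.+ suc y
    rearrange = solveₙ-∀
    rearrange′ : ∀ x y z → x ℕ.+ y ℕ.+ z ≡ x ℕ.+ z ℕ.+ y
    rearrange′ = solveₙ-∀
    partial : ∀ k → sumFrom1 k (λ i → quot (suc j) (p ^ i)) ≡ sumFrom1 k (λ i → quot j (p ^ i)) ℕ.+ (k ⊓ a)
    partial zero = refl
    partial (suc k) with suc k ℕ.≤? a
    ... | yes k<a = begin
      sumFrom1 k (λ i → quot (suc j) (p ^ i)) ℕ.+ quot (suc j) (p ^ suc k)
        ≡⟨ cong₂ ℕ._+_ (partial k) (quot-suc-∣ j (p ^ suc k) {{p^ suc k ≢0}}
             (ℕ∣.∣-trans (p^∣p^ k<a) (ℕ∣.divides u (trans 1+j≡ (ℕ.*-comm (p ^ a) u))))) ⟩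
      prev ℕ.+ (k ⊓ a) ℕ.+ suc (quot j (p ^ suc k))
        ≡⟨ rearrange prev (k ⊓ a) (quot j (p ^ suc k)) ⟩
      prev ℕ.+ quot j (p ^ suc k) ℕ.+ suc (k ⊓ a)
        ≡⟨ cong (prev ℕ.+ quot j (p ^ suc k) ℕ.+_)
             (trans (cong suc (ℕ.m≤n⇒m⊓n≡m (ℕ.<⇒≤ k<a))) (sym (ℕ.m≤n⇒m⊓n≡m k<a))) ⟩
      prev ℕ.+ quot j (p ^ suc k) ℕ.+ (suc k ⊓ a) ∎
      where prev = sumFrom1 k (λ i → quot j (p ^ i))
    ... | no k≮a = begin
      sumFrom1 k (λ i → quot (suc j) (p ^ i)) ℕ.+ quot (suc j) (p ^ suc k)
        ≡⟨ cong₂ ℕ._+_ (partial k) (quot-suc-∤ j (p ^ suc k) {{p^ suc k ≢0}}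
             λ div → k≮a (p^-cancel p∤u (subst (p ^ suc k ∣ₙ_) 1+j≡ div))) ⟩
      prev ℕ.+ (k ⊓ a) ℕ.+ quot j (p ^ suc k)
        ≡⟨ rearrange′ prev (k ⊓ a) (quot j (p ^ suc k)) ⟩
      prev ℕ.+ quot j (p ^ suc k) ℕ.+ (k ⊓ a)
        ≡⟨ cong (prev ℕ.+ quot j (p ^ suc k) ℕ.+_)
             (trans (ℕ.m≥n⇒m⊓n≡n a≤k) (sym (ℕ.m≥n⇒m⊓n≡n (ℕ.m≤n⇒m≤1+n a≤k)))) ⟩
      prev ℕ.+ quot j (p ^ suc k) ℕ.+ (suc k ⊓ a) ∎
      where
      prev = sumFrom1 k (λ i → quot j (p ^ i))
      a≤k = ℕ.≮⇒≥ k≮a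

  -- Legendre's formula, as an explicit splitting of `j !` so that its two factors can be cancelled
  -- separately.
  legendre : ∀ j → Σ[ u ∈ ℕ ] (j ! ≡ p ^ α p j ℕ.* u × ¬ (p ∣ₙ u))
  legendre zero = 1 , refl , λ p∣1 → ℕ.<⇒≱ (ℕ.nonTrivial⇒n>1 p) (ℕ∣.∣⇒≤ p∣1)
  legendre (suc j) with legendre j | p-part (suc j)
  ... | u , j!≡ , p∤u | a , w , 1+j≡ , p∤w = w ℕ.* u , (begin
    suc j ℕ.* j !                               ≡⟨ cong₂ ℕ._*_ 1+j≡ j!≡ ⟩
    p ^ a ℕ.* w ℕ.* (p ^ α p j ℕ.* u)           ≡⟨ rearrange (p ^ a) w (p ^ α p j) u ⟩
    p ^ α p j ℕ.* p ^ a ℕ.* (w ℕ.* u)           ≡⟨ cong (ℕ._* (w ℕ.* u)) (ℕ.^-distribˡ-+-* p (α p j) a) ⟨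
    p ^ (α p j ℕ.+ a) ℕ.* (w ℕ.* u)             ≡⟨ cong (λ z → p ^ z ℕ.* (w ℕ.* u)) (α-suc j a w 1+j≡ p∤w) ⟨
    p ^ α p (suc j) ℕ.* (w ℕ.* u)               ∎) , p∤wu
    where
    open ≡-Reasoning
    rearrange : ∀ a w b u → a ℕ.* w ℕ.* (b ℕ.* u) ≡ b ℕ.* a ℕ.* (w ℕ.* u)
    rearrange = solveₙ-∀
    p∤wu : ¬ (p ∣ₙ w ℕ.* u)
    p∤wu div with euclidsLemma w u pp div
    ... | inj₁ p∣w = p∤w p∣w
    ... | inj₂ p∣u = p∤u p∣u

  p^∣-coprime : ∀ d u c → ¬ (p ∣ₙ u) → p ^ d ∣ₙ u ℕ.* c → p ^ d ∣ₙ c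
  p^∣-coprime zero u c p∤u div = ℕ∣.1∣ c
  p^∣-coprime (suc d) u c p∤u div with euclidsLemma u c pp (ℕ∣.∣-trans (ℕ∣.m∣m*n (p ^ d)) div)
  ... | inj₁ p∣u = ⊥-elim (p∤u p∣u)
  ... | inj₂ (ℕ∣.divides c′ refl) = subst (p ^ suc d ∣ₙ_) (ℕ.*-comm p c′)
    (ℕ∣.*-monoʳ-∣ p (p^∣-coprime d u c′ p∤u
      (ℕ∣.*-cancelˡ-∣ p (subst (p ^ suc d ∣ₙ_) (rearrange u c′ p) div))))
    where
    rearrange : ∀ u c p → u ℕ.* (c ℕ.* p) ≡ p ℕ.* (u ℕ.* c)
    rearrange = solveₙ-∀

  -- Turns divisibility of a difference, which is `j !` times a Newton coefficient, into
  -- divisibility of the coefficient itself.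
  factorial-cancel : ∀ q j c → p ^ q ∣ₙ j ! ℕ.* c → p ^ (q ∸ α p j) ∣ₙ c
  factorial-cancel q j c div with legendre j | ℕ.≤-total q (α p j)
  ... | u , j!≡ , p∤u | inj₁ q≤α = subst (λ z → p ^ z ∣ₙ c) (sym (ℕ.m≤n⇒m∸n≡0 q≤α)) (ℕ∣.1∣ c)
  ... | u , j!≡ , p∤u | inj₂ α≤q = p^∣-coprime (q ∸ α p j) u c p∤u (ℕ∣.*-cancelˡ-∣ (p ^ α p j) {{p^ α p j ≢0}}
    (subst₂ _∣ₙ_ p^q≡ (trans (cong (ℕ._* c) j!≡) (ℕ.*-assoc (p ^ α p j) u c)) div))
    where
    p^q≡ : p ^ q ≡ p ^ α p j ℕ.* p ^ (q ∸ α p j)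
    p^q≡ = trans (cong (p ^_) (sym (ℕ.m+[n∸m]≡n α≤q))) (ℕ.^-distribˡ-+-* p (α p j) (q ∸ α p j))

  p^∣1⇒≡0 : ∀ k → p ^ k ∣ₙ 1 → k ≡ 0
  p^∣1⇒≡0 k div = ℕ.n<1⇒n≡0 (ℕ.<-≤-trans (k<p^k k) (ℕ∣.∣⇒≤ div))

  p^∣!⇒≤α : ∀ q j → p ^ q ∣ₙ j ! → q ≤ α p j
  p^∣!⇒≤α q j div = ℕ.m∸n≡0⇒m≤n (p^∣1⇒≡0 (q ∸ α p j)
    (factorial-cancel q j 1 (subst (p ^ q ∣ₙ_) (sym (ℕ.*-identityʳ (j !))) div)))

  p^α∣! : ∀ j → p ^ α p j ∣ₙ j !
  p^α∣! j with legendre j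
  ... | u , j!≡ , _ = ℕ∣.divides u (trans j!≡ (ℕ.*-comm (p ^ α p j) u))

  -- Integrality of binomial coefficients: i! j! divides (i+j)!.
  α-superadditive : ∀ i j → α p i ℕ.+ α p j ≤ α p (i ℕ.+ j)
  α-superadditive i j = p^∣!⇒≤α (α p i ℕ.+ α p j) (i ℕ.+ j) (subst (_∣ₙ (i ℕ.+ j) !)
    (sym (ℕ.^-distribˡ-+-* p (α p i) (α p j)))
    (ℕ∣.∣-trans (ℕ∣.*-pres-∣ (p^α∣! i) (p^α∣! j))
      (subst (λ z → i ! ℕ.* z ! ∣ₙ (i ℕ.+ j) !) (ℕ.m+n∸m≡n i j) (k![n∸k]!∣n! (ℕ.m≤m+n i j)))))

  α-mono : ∀ {i j} → i ≤ j → α p i ≤ α p j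
  α-mono {i} {j} i≤j = ℕ.≤-trans (ℕ.m≤m+n (α p i) (α p (j ∸ i)))
    (subst (λ z → α p i ℕ.+ α p (j ∸ i) ≤ α p z) (ℕ.m+[n∸m]≡n i≤j) (α-superadditive i (j ∸ i)))

  -- Shows that the search range in `β` is long enough: each block of p consecutive factors
  -- contributes at least one, since α(p) ≥ 1.
  m≤α[m*p] : ∀ m → m ≤ α p (m ℕ.* p)
  m≤α[m*p] zero = z≤n
  m≤α[m*p] (suc m) = ℕ.≤-trans (ℕ.+-mono-≤ 1≤αp (m≤α[m*p] m)) (α-superadditive p (m ℕ.* p))
    where
    p∣p! : ∀ n .{{_ : ℕ.NonZero n}} → n ∣ₙ n !
    p∣p! (suc n) = ℕ∣.m∣m*n (n !)
    1≤αp : 1 ≤ α p p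
    1≤αp = p^∣!⇒≤α 1 p (subst (_∣ₙ p !) (sym (ℕ.^-identityʳ p)) (p∣p! p))

  m≤α[β] : ∀ m → m ≤ α p (β p m)
  m≤α[β] m = ℕ.≤ᵇ⇒≤ m (α p (β p m))
    (subst T (sym (search-hit (m ℕ.* p) (λ j → m ≤ᵇ α p j) (hit (ℕ.≤⇒≤ᵇ (m≤α[m*p] m))))) tt)
    where
    hit : ∀ {b} → T b → b ≡ true
    hit {true} _ = refl

  <β⇒α< : ∀ m j → j < β p m → α p j < m
  <β⇒α< m j j<β = ℕ.≰⇒> λ m≤α → subst T (search-below (m ℕ.* p) (λ j → m ≤ᵇ α p j) j j<β) (ℕ.≤⇒≤ᵇ m≤α)

  -- With `m≤α[β]` and monotonicity of α this makes β the lower adjoint of α, so superadditivity of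
  -- α becomes subadditivity of β.
  ≤α⇒β≤ : ∀ {m j} → m ≤ α p j → β p m ≤ j
  ≤α⇒β≤ {m} {j} m≤α = ℕ.≮⇒≥ λ j<β → ℕ.<⇒≱ (<β⇒α< m j j<β) m≤α

  β-mono : ∀ {k m} → k ≤ m → β p k ≤ β p m
  β-mono {k} {m} k≤m = ≤α⇒β≤ (ℕ.≤-trans k≤m (m≤α[β] m))

  β-subadditive : ∀ k m → β p (k ℕ.+ m) ≤ β p k ℕ.+ β p m
  β-subadditive k m = ≤α⇒β≤ (ℕ.≤-trans (ℕ.+-mono-≤ (m≤α[β] k) (m≤α[β] m)) (α-superadditive (β p k) (β p m)))

  -- The indices l with α(l) ≤ q are exactly those below β(q+1).
  deficit-suc : ∀ q N →
    sumBelowℕ N (λ l → suc q ∸ α p l) ≡ sumBelowℕ N (λ l → q ∸ α p l) ℕ.+ (N ⊓ β p (suc q))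
  deficit-suc q zero = refl
  deficit-suc q (suc N) with suc N ℕ.≤? β p (suc q)
  ... | yes N<β = begin
    sumBelowℕ N (λ l → suc q ∸ α p l) ℕ.+ (suc q ∸ α p N)
      ≡⟨ cong₂ ℕ._+_ (deficit-suc q N) (ℕ.+-∸-assoc 1 (ℕ.s≤s⁻¹ (<β⇒α< (suc q) N N<β))) ⟩
    prev ℕ.+ (N ⊓ β p (suc q)) ℕ.+ suc (q ∸ α p N)
      ≡⟨ rearrange prev (N ⊓ β p (suc q)) (q ∸ α p N) ⟩
    prev ℕ.+ (q ∸ α p N) ℕ.+ suc (N ⊓ β p (suc q))
      ≡⟨ cong (prev ℕ.+ (q ∸ α p N) ℕ.+_)
           (trans (cong suc (ℕ.m≤n⇒m⊓n≡m (ℕ.<⇒≤ N<β))) (sym (ℕ.m≤n⇒m⊓n≡m N<β))) ⟩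
    prev ℕ.+ (q ∸ α p N) ℕ.+ (suc N ⊓ β p (suc q)) ∎
    where
    open ≡-Reasoning
    prev = sumBelowℕ N (λ l → q ∸ α p l)
    rearrange : ∀ x y z → x ℕ.+ y ℕ.+ suc z ≡ x ℕ.+ z ℕ.+ suc y
    rearrange = solveₙ-∀
  ... | no N≮β = begin
    sumBelowℕ N (λ l → suc q ∸ α p l) ℕ.+ (suc q ∸ α p N)
      ≡⟨ cong₂ ℕ._+_ (deficit-suc q N) (trans (ℕ.m≤n⇒m∸n≡0 q<α) (sym (ℕ.m≤n⇒m∸n≡0 (ℕ.<⇒≤ q<α)))) ⟩
    prev ℕ.+ (N ⊓ β p (suc q)) ℕ.+ (q ∸ α p N)
      ≡⟨ rearrange prev (N ⊓ β p (suc q)) (q ∸ α p N) ⟩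
    prev ℕ.+ (q ∸ α p N) ℕ.+ (N ⊓ β p (suc q))
      ≡⟨ cong (prev ℕ.+ (q ∸ α p N) ℕ.+_)
           (trans (ℕ.m≥n⇒m⊓n≡n β≤N) (sym (ℕ.m≥n⇒m⊓n≡n (ℕ.m≤n⇒m≤1+n β≤N)))) ⟩
    prev ℕ.+ (q ∸ α p N) ℕ.+ (suc N ⊓ β p (suc q)) ∎
    where
    open ≡-Reasoning
    prev = sumBelowℕ N (λ l → q ∸ α p l)
    β≤N = ℕ.≮⇒≥ N≮β
    q<α : suc q ≤ α p N
    q<α = ℕ.≤-trans (m≤α[β] (suc q)) (α-mono β≤N)
    rearrange : ∀ x y z → x ℕ.+ y ℕ.+ z ≡ x ℕ.+ z ℕ.+ y
    rearrange = solveₙ-∀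

  deficit-zero : ∀ N → sumBelowℕ N (λ l → 0 ∸ α p l) ≡ 0
  deficit-zero zero = refl
  deficit-zero (suc N) = cong₂ ℕ._+_ (deficit-zero N) (ℕ.0∸n≡0 (α p N))

  -- Used for the rows, where an upper bound suffices: every increment is β cut off at `N`.
  deficit-≤ : ∀ q N → sumBelowℕ N (λ l → q ∸ α p l) ≤ B p q
  deficit-≤ zero N = ℕ.≤-reflexive (deficit-zero N)
  deficit-≤ (suc q) N = ℕ.≤-trans (ℕ.≤-reflexive (deficit-suc q N))
    (ℕ.+-mono-≤ (deficit-≤ q N) (ℕ.m⊓n≤n N (β p (suc q))))

  -- Used for the columns. By monotonicity of β none of the increments is cut off once the last one
  -- is not.
  deficit-≡ : ∀ q N → β p q ≤ N → sumBelowℕ N (λ l → q ∸ α p l) ≡ B p q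
  deficit-≡ zero N β≤N = deficit-zero N
  deficit-≡ (suc q) N β≤N = trans (deficit-suc q N)
    (cong₂ ℕ._+_ (deficit-≡ q N (ℕ.≤-trans (β-mono (ℕ.n≤1+n q)) β≤N)) (ℕ.m≥n⇒m⊓n≡n β≤N))

-- Finite differences and falling factorials

sumBelow : ℕ → (ℕ → ℤ) → ℤ
sumBelow zero h = 0ℤ
sumBelow (suc n) h = sumBelow n h + h n

sumBelow-cong : ∀ n (h k : ℕ → ℤ) → (∀ i → i < n → h i ≡ k i) → sumBelow n h ≡ sumBelow n k
sumBelow-cong zero h k eq = refl
sumBelow-cong (suc n) h k eq =
  cong₂ _+_ (sumBelow-cong n h k λ i i<n → eq i (ℕ.m<n⇒m<1+n i<n)) (eq n (ℕ.n<1+n n))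

sumBelow-zero : ∀ n (h : ℕ → ℤ) → (∀ i → i < n → h i ≡ 0ℤ) → sumBelow n h ≡ 0ℤ
sumBelow-zero zero h eq = refl
sumBelow-zero (suc n) h eq =
  cong₂ _+_ (sumBelow-zero n h λ i i<n → eq i (ℕ.m<n⇒m<1+n i<n)) (eq n (ℕ.n<1+n n))

sumBelow-+ : ∀ n (h k : ℕ → ℤ) → sumBelow n (λ i → h i + k i) ≡ sumBelow n h + sumBelow n k
sumBelow-+ zero h k = refl
sumBelow-+ (suc n) h k = trans (cong (_+ (h n + k n)) (sumBelow-+ n h k))
  (interchange (sumBelow n h) (sumBelow n k) (h n) (k n))
  where
  interchange : ∀ a b c d → (a + b) + (c + d) ≡ (a + c) + (b + d)
  interchange = solve-∀

sumBelow-*ˡ : ∀ n c (h : ℕ → ℤ) → sumBelow n (λ i → c * h i) ≡ c * sumBelow n h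
sumBelow-*ˡ zero c h = sym (ℤ.*-zeroʳ c)
sumBelow-*ˡ (suc n) c h = trans (cong (_+ c * h n) (sumBelow-*ˡ n c h)) (sym (ℤ.*-distribˡ-+ c (sumBelow n h) (h n)))

sumBelow-split : ∀ m n (h : ℕ → ℤ) → sumBelow (m ℕ.+ n) h ≡ sumBelow m h + sumBelow n (λ i → h (m ℕ.+ i))
sumBelow-split m zero h = trans (cong (λ z → sumBelow z h) (ℕ.+-identityʳ m)) (sym (ℤ.+-identityʳ (sumBelow m h)))
sumBelow-split m (suc n) h = begin
  sumBelow (m ℕ.+ suc n) h
    ≡⟨ cong (λ z → sumBelow z h) (ℕ.+-suc m n) ⟩
  sumBelow (m ℕ.+ n) h + h (m ℕ.+ n)
    ≡⟨ cong (_+ h (m ℕ.+ n)) (sumBelow-split m n h) ⟩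
  sumBelow m h + sumBelow n (λ i → h (m ℕ.+ i)) + h (m ℕ.+ n)
    ≡⟨ ℤ.+-assoc (sumBelow m h) (sumBelow n (λ i → h (m ℕ.+ i))) (h (m ℕ.+ n)) ⟩
  sumBelow m h + sumBelow (suc n) (λ i → h (m ℕ.+ i)) ∎
  where open ≡-Reasoning

-- Sylvester columns run from the highest power down, sums of coefficients from the lowest power up;
-- this converts between the two.
sumFin-reverse : ∀ n (h : ℕ → ℤ) → sumFin n (λ j → h (n ∸ suc (toℕ j))) ≡ sumBelow n h
sumFin-reverse zero h = refl
sumFin-reverse (suc n) h = trans (cong (_+_ (h n)) (sumFin-reverse n h)) (ℤ.+-comm (h n) (sumBelow n h))

sumBelowℕ-split : ∀ m n h → sumBelowℕ (m ℕ.+ n) h ≡ sumBelowℕ m h ℕ.+ sumBelowℕ n (λ i → h (m ℕ.+ i))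
sumBelowℕ-split m zero h = trans (cong (λ z → sumBelowℕ z h) (ℕ.+-identityʳ m)) (sym (ℕ.+-identityʳ (sumBelowℕ m h)))
sumBelowℕ-split m (suc n) h = trans (cong (λ z → sumBelowℕ z h) (ℕ.+-suc m n))
  (trans (cong (ℕ._+ h (m ℕ.+ n)) (sumBelowℕ-split m n h))
    (ℕ.+-assoc (sumBelowℕ m h) (sumBelowℕ n (λ i → h (m ℕ.+ i))) (h (m ℕ.+ n))))

sumBelowℕ-cong : ∀ n (h k : ℕ → ℕ) → (∀ i → i < n → h i ≡ k i) → sumBelowℕ n h ≡ sumBelowℕ n k
sumBelowℕ-cong zero h k eq = refl
sumBelowℕ-cong (suc n) h k eq =
  cong₂ ℕ._+_ (sumBelowℕ-cong n h k λ i i<n → eq i (ℕ.m<n⇒m<1+n i<n)) (eq n (ℕ.n<1+n n))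

Δ : ℕ → (ℤ → ℤ) → ℤ → ℤ
Δ zero F x = F x
Δ (suc l) F x = Δ l F (1ℤ + x) - Δ l F x

Δ-cong : ∀ l (F G : ℤ → ℤ) → (∀ x → F x ≡ G x) → ∀ y → Δ l F y ≡ Δ l G y
Δ-cong zero F G eq y = eq y
Δ-cong (suc l) F G eq y = cong₂ _-_ (Δ-cong l F G eq (1ℤ + y)) (Δ-cong l F G eq y)

Δ-∣ : ∀ l d (F : ℤ → ℤ) → (∀ x → d ∣ₛ F x) → ∀ y → d ∣ₛ Δ l F y
Δ-∣ zero d F div y = div y
Δ-∣ (suc l) d F div y = Signed.∣m∣n⇒∣m-n (Δ-∣ l d F div (1ℤ + y)) (Δ-∣ l d F div y)

Δ-sum : ∀ l n (c : ℕ → ℤ) (H : ℕ → ℤ → ℤ) y →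
  Δ l (λ x → sumBelow n (λ e → c e * H e x)) y ≡ sumBelow n (λ e → c e * Δ l (H e) y)
Δ-sum zero n c H y = refl
Δ-sum (suc l) n c H y = begin
  Δ l Σ (1ℤ + y) - Δ l Σ y
    ≡⟨ cong₂ _-_ (Δ-sum l n c H (1ℤ + y)) (Δ-sum l n c H y) ⟩
  sumBelow n (λ e → c e * Δ l (H e) (1ℤ + y)) - sumBelow n (λ e → c e * Δ l (H e) y)
    ≡⟨ difference n (λ e → Δ l (H e) (1ℤ + y)) (λ e → Δ l (H e) y) ⟩
  sumBelow n (λ e → c e * Δ (suc l) (H e) y) ∎
  where
  open ≡-Reasoning
  Σ = λ x → sumBelow n (λ e → c e * H e x)
  regroup : ∀ a b c x y → a + c * x - (b + c * y) ≡ (a - b) + c * (x - y)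
  regroup = solve-∀
  difference : ∀ n (u v : ℕ → ℤ) →
    sumBelow n (λ e → c e * u e) - sumBelow n (λ e → c e * v e) ≡ sumBelow n (λ e → c e * (u e - v e))
  difference zero u v = refl
  difference (suc n) u v =
    trans (regroup (sumBelow n (λ e → c e * u e)) (sumBelow n (λ e → c e * v e)) (c n) (u n) (v n))
      (cong (_+ c n * (u n - v n)) (difference n u v))

Δ-const : ∀ l c y → Δ (suc l) (λ _ → c) y ≡ 0ℤ
Δ-const zero c y = ℤ.+-inverseʳ c
Δ-const (suc l) c y = cong₂ _-_ (Δ-const l c (1ℤ + y)) (Δ-const l c y)

-- The Leibniz rule for the factor x, whose second difference vanishes, written with all differences
-- taken at `y`.
Δ-x* : ∀ k (F : ℤ → ℤ) y →
  Δ (suc k) (λ x → x * F x) y ≡ (y + + suc k) * Δ (suc k) F y + + suc k * Δ k F y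
Δ-x* zero F y = regroup y (F (1ℤ + y)) (F y)
  where
  regroup : ∀ y a b → (1ℤ + y) * a - y * b ≡ (y + 1ℤ) * (a - b) + 1ℤ * b
  regroup = solve-∀
Δ-x* (suc k) F y = trans (cong₂ _-_ (Δ-x* k F (1ℤ + y)) (Δ-x* k F y))
  (regroup y (+ suc k) (Δ (suc k) F (1ℤ + y)) (Δ k F (1ℤ + y)) (Δ k F y))
  where
  regroup : ∀ y κ a b c → ((1ℤ + y + κ) * a + κ * b) - ((y + κ) * (b - c) + κ * c)
    ≡ (y + (1ℤ + κ)) * (a - (b - c)) + (1ℤ + κ) * (b - c)
  regroup = solve-∀

-- x ^ j = Σ_l newton y j l · (x − y)(x − y − 1)⋯(x − y − l + 1)
newton : ℤ → ℕ → ℕ → ℤ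
newton y zero zero = 1ℤ
newton y zero (suc l) = 0ℤ
newton y (suc j) zero = y * newton y j zero
newton y (suc j) (suc l) = (y + + suc l) * newton y j (suc l) + newton y j l

-- Multiplied by `l !`, the recursion of `newton` becomes the Leibniz rule `Δ-x*`.
newton-Δ : ∀ y j l → + (l !) * newton y j l ≡ Δ l (ℤ._^ j) y
newton-Δ y zero zero = refl
newton-Δ y zero (suc l) = trans (ℤ.*-zeroʳ (+ (suc l !))) (sym (Δ-const l 1ℤ y))
newton-Δ y (suc j) zero = trans (ℤ.*-identityˡ (y * newton y j zero))
  (cong (y *_) (trans (sym (ℤ.*-identityˡ (newton y j zero))) (newton-Δ y j zero)))
newton-Δ y (suc j) (suc l) = begin
  + (suc l !) * ((y + + suc l) * a + b)
    ≡⟨ cong (_* ((y + + suc l) * a + b)) (ℤ.pos-* (suc l) (l !)) ⟩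
  + suc l * + (l !) * ((y + + suc l) * a + b)
    ≡⟨ regroup (+ suc l) (+ (l !)) y a b ⟩
  (y + + suc l) * (+ suc l * + (l !) * a) + + suc l * (+ (l !) * b)
    ≡⟨ cong₂ (λ u v → (y + + suc l) * u + + suc l * v)
         (trans (cong (_* a) (sym (ℤ.pos-* (suc l) (l !)))) (newton-Δ y j (suc l))) (newton-Δ y j l) ⟩
  (y + + suc l) * Δ (suc l) (ℤ._^ j) y + + suc l * Δ l (ℤ._^ j) y
    ≡⟨ Δ-x* l (ℤ._^ j) y ⟨
  Δ (suc l) (ℤ._^ suc j) y ∎
  where
  open ≡-Reasoning
  a = newton y j (suc l)
  b = newton y j l
  regroup : ∀ s f y a b → s * f * ((y + s) * a + b) ≡ (y + s) * (s * f * a) + s * (f * b)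
  regroup = solve-∀

newton-upper : ∀ y j l → j < l → newton y j l ≡ 0ℤ
newton-upper y zero (suc l) j<l = refl
newton-upper y (suc j) (suc l) (s≤s j<l) =
  cong₂ _+_ (trans (cong ((y + + suc l) *_) (newton-upper y j (suc l) (ℕ.m<n⇒m<1+n j<l))) (ℤ.*-zeroʳ (y + + suc l)))
    (newton-upper y j l j<l)

newton-diagonal : ∀ y j → newton y j j ≡ 1ℤ
newton-diagonal y zero = refl
newton-diagonal y (suc j) =
  cong₂ _+_ (trans (cong ((y + + suc j) *_) (newton-upper y j (suc j) (ℕ.n<1+n j))) (ℤ.*-zeroʳ (y + + suc j)))
    (newton-diagonal y j)

falling : ℕ → ℤ → ℤ
falling zero x = 1ℤ
falling (suc d) x = (x - + d) * falling d x

-- The product (1+x) x ⋯ (x-d+1) with its other end split off; subtracting the two forms gives the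
-- difference of `falling (suc d)` as (d+1) `falling d`.
falling-1+ : ∀ d x → falling (suc d) (1ℤ + x) ≡ (1ℤ + x) * falling d x
falling-1+ zero x = cong (_* 1ℤ) (ℤ.+-identityʳ (1ℤ + x))
falling-1+ (suc d) x = trans (cong ((1ℤ + x - + suc d) *_) (falling-1+ d x)) (regroup x (+ d) (falling d x))
  where
  regroup : ∀ x d f → (1ℤ + x - (1ℤ + d)) * ((1ℤ + x) * f) ≡ (1ℤ + x) * ((x - d) * f)
  regroup = solve-∀

∣-induction : ∀ d (F : ℤ → ℤ) → d ∣ₛ F 0ℤ → (∀ x → d ∣ₛ F (1ℤ + x) - F x) → ∀ x → d ∣ₛ F x
∣-induction d F base step (+ zero) = base
∣-induction d F base step (+ suc n) =
  subst (d ∣ₛ_) (cancel (F (+ suc n)) (F (+ n))) (Signed.∣m∣n⇒∣m+n (step (+ n)) (∣-induction d F base step (+ n)))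
  where
  cancel : ∀ a b → (a - b) + b ≡ a
  cancel = solve-∀
∣-induction d F base step -[1+ n ] =
  subst (d ∣ₛ_) (cancel (F (1ℤ + -[1+ n ])) (F -[1+ n ])) (Signed.∣m∣n⇒∣m-n (previous n) (step -[1+ n ]))
  where
  cancel : ∀ a b → a - (a - b) ≡ b
  cancel = solve-∀
  previous : ∀ n → d ∣ₛ F (1ℤ + -[1+ n ])
  previous zero = base
  previous (suc n) = ∣-induction d F base step -[1+ n ]

!∣falling : ∀ d x → + (d !) ∣ₛ falling d x
!∣falling zero x = Signed.∣-refl
!∣falling (suc d) = ∣-induction (+ (suc d !)) (falling (suc d))
  -- The base point 0 is read as 1 + (-1), so that the split-off factor is 0.
  (subst (+ (suc d !) ∣ₛ_) (sym (falling-1+ d -1ℤ)) (Signed.divides 0ℤ refl))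
  λ x → subst₂ _∣ₛ_ (sym (ℤ.pos-* (suc d) (d !))) (sym (difference x)) (Signed.*-monoʳ-∣ (+ suc d) (!∣falling d x))
  where
  regroup : ∀ x d f → (1ℤ + x) * f - (x - d) * f ≡ (1ℤ + d) * f
  regroup = solve-∀
  difference : ∀ x → falling (suc d) (1ℤ + x) - falling (suc d) x ≡ + suc d * falling d x
  difference x = trans (cong (_- falling (suc d) x) (falling-1+ d x)) (regroup x (+ d) (falling d x))

-- The signed Stirling numbers of the first kind; the recursion is multiplication by x - d.
fallingCoeff : ℕ → ℕ → ℤ
fallingCoeff zero zero = 1ℤ
fallingCoeff zero (suc k) = 0ℤ
fallingCoeff (suc d) zero = - + d * fallingCoeff d zero
fallingCoeff (suc d) (suc k) = fallingCoeff d k + - + d * fallingCoeff d (suc k)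

fallingCoeff-upper : ∀ d k → d < k → fallingCoeff d k ≡ 0ℤ
fallingCoeff-upper zero (suc k) d<k = refl
fallingCoeff-upper (suc d) (suc k) (s≤s d<k) = cong₂ _+_ (fallingCoeff-upper d k d<k)
  (trans (cong (- + d *_) (fallingCoeff-upper d (suc k) (ℕ.m<n⇒m<1+n d<k))) (ℤ.*-zeroʳ (- + d)))

fallingCoeff-diagonal : ∀ d → fallingCoeff d d ≡ 1ℤ
fallingCoeff-diagonal zero = refl
fallingCoeff-diagonal (suc d) = cong₂ _+_ (fallingCoeff-diagonal d)
  (trans (cong (- + d *_) (fallingCoeff-upper d (suc d) (ℕ.n<1+n d))) (ℤ.*-zeroʳ (- + d)))

-- The number of terms is free, as the sum will run over a whole block of the row matrix. The
-- induction needs this too: the part multiplied by x has one term fewer than the part multiplied by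
-- -d.
falling-sum : ∀ d n x → d < n → sumBelow n (λ k → fallingCoeff d k * x ℤ.^ k) ≡ falling d x
falling-sum zero (suc n) x d<n = trans (sumBelow-split 1 n (λ k → fallingCoeff zero k * x ℤ.^ k))
  (cong (_+_ (0ℤ + 1ℤ)) (sumBelow-zero n (λ k → 0ℤ * x ℤ.^ suc k) λ k _ → ℤ.*-zeroˡ (x ℤ.^ suc k)))
falling-sum (suc d) (suc n) x (s≤s d<n) = begin
  sumBelow (suc n) (λ k → fallingCoeff (suc d) k * x ℤ.^ k)
    ≡⟨ sumBelow-split 1 n (λ k → fallingCoeff (suc d) k * x ℤ.^ k) ⟩
  0ℤ + - + d * c zero * 1ℤ + sumBelow n (λ k → (c k + - + d * c (suc k)) * (x * x ℤ.^ k))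
    ≡⟨ cong (_+_ (0ℤ + - + d * c zero * 1ℤ)) (begin
         sumBelow n (λ k → (c k + - + d * c (suc k)) * (x * x ℤ.^ k))
           ≡⟨ sumBelow-cong n (λ k → (c k + - + d * c (suc k)) * (x * x ℤ.^ k)) (λ k → x * term k + - + d * term (suc k))
                (λ k _ → distribute (c k) (- + d) (c (suc k)) x (x ℤ.^ k)) ⟩
         sumBelow n (λ k → x * term k + - + d * term (suc k))
           ≡⟨ sumBelow-+ n (λ k → x * term k) (λ k → - + d * term (suc k)) ⟩
         sumBelow n (λ k → x * term k) + sumBelow n (λ k → - + d * term (suc k))
           ≡⟨ cong₂ _+_ (sumBelow-*ˡ n x term) (sumBelow-*ˡ n (- + d) (term ∘ suc)) ⟩
         x * sumBelow n term + - + d * tail ∎) ⟩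
  0ℤ + - + d * c zero * 1ℤ + (x * sumBelow n term + - + d * tail)
    ≡⟨ regroup (- + d) (c zero) x (sumBelow n term) tail ⟩
  x * sumBelow n term + - + d * (0ℤ + c zero * 1ℤ + tail)
    ≡⟨ cong₂ (λ u v → x * u + - + d * v) (falling-sum d n x d<n)
         (trans (sym (sumBelow-split 1 n term)) (falling-sum d (suc n) x (ℕ.m<n⇒m<1+n d<n))) ⟩
  x * falling d x + - + d * falling d x
    ≡⟨ ℤ.*-distribʳ-+ (falling d x) x (- + d) ⟨
  falling (suc d) x ∎
  where
  open ≡-Reasoning
  c = fallingCoeff d
  term : ℕ → ℤ
  term k = c k * x ℤ.^ k
  tail = sumBelow n (term ∘ suc)
  distribute : ∀ a d b x y → (a + d * b) * (x * y) ≡ x * (a * y) + d * (b * (x * y))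
  distribute = solve-∀
  regroup : ∀ d a x s t → 0ℤ + d * a * 1ℤ + (x * s + d * t) ≡ x * s + d * (0ℤ + a * 1ℤ + t)
  regroup = solve-∀

-- Monic polynomials and the Sylvester matrix

mutual
  -- The helper function local to eval has no name in scope; it is recovered by unification in eval-step.
  partialEval : MonicPoly → ℤ → ℕ → ℤ
  partialEval f x k = _

  eval-step : ∀ f x → eval f x ≡ partialEval f x (deg f) + coeff f (deg f) * x ℤ.^ deg f
  eval-step f x with deg f | lower f | _+_
  ... | _ | _ | _ = refl

eval-sum : ∀ f x → eval f x ≡ sumBelow (suc (deg f)) (λ k → coeff f k * x ℤ.^ k)
eval-sum f x = partialEval-sum (suc (deg f))
  where
  partialEval-sum : ∀ k → partialEval f x k ≡ sumBelow k (λ k → coeff f k * x ℤ.^ k)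
  partialEval-sum zero = refl
  partialEval-sum (suc k) = cong (_+ coeff f k * x ℤ.^ k) (partialEval-sum k)

mutual
  coeff-deg : ∀ f → coeff f (deg f) ≡ 1ℤ
  coeff-deg (monic zero []) = refl
  coeff-deg (monic (suc d) (a ∷ᵥ c)) with suc d | a ∷ᵥ c
  ... | d₀ | c₀ = coeff-go d₀ c₀ d c

  -- The blank is the helper function local to coeff, found by unification in coeff-deg.
  coeff-go : ∀ d₀ (c₀ : Vec ℤ d₀) d (c : Vec ℤ d) → _ ≡ 1ℤ
  coeff-go d₀ c₀ zero [] = refl
  coeff-go d₀ c₀ (suc d) (a ∷ᵥ c) = coeff-go d₀ c₀ d c

Δ-deg : ∀ f y → Δ (deg f) (eval f) y ≡ + (deg f !)
Δ-deg f y = begin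
  Δ d (eval f) y
    ≡⟨ Δ-cong d (eval f) (λ x → sumBelow (suc d) (λ k → coeff f k * x ℤ.^ k)) (eval-sum f) y ⟩
  Δ d (λ x → sumBelow (suc d) (λ k → coeff f k * x ℤ.^ k)) y
    ≡⟨ Δ-sum d (suc d) (coeff f) (λ k x → x ℤ.^ k) y ⟩
  sumBelow d (λ k → coeff f k * Δ d (ℤ._^ k) y) + coeff f d * Δ d (ℤ._^ d) y
    ≡⟨ cong₂ _+_ (sumBelow-zero d (λ k → coeff f k * Δ d (ℤ._^ k) y) vanish)
         (cong₂ _*_ (coeff-deg f) (sym (newton-Δ y d d))) ⟩
  0ℤ + 1ℤ * (+ (d !) * newton y d d)
    ≡⟨ cong (λ z → 0ℤ + 1ℤ * (+ (d !) * z)) (newton-diagonal y d) ⟩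
  0ℤ + 1ℤ * (+ (d !) * 1ℤ)
    ≡⟨ simplify (+ (d !)) ⟩
  + (d !) ∎
  where
  open ≡-Reasoning
  d = deg f
  simplify : ∀ a → 0ℤ + 1ℤ * (a * 1ℤ) ≡ a
  simplify = solve-∀
  vanish : ∀ k → k < d → coeff f k * Δ d (ℤ._^ k) y ≡ 0ℤ
  vanish k k<d = trans (cong (coeff f k *_) (trans (sym (newton-Δ y k d))
    (trans (cong (+ (d !) *_) (newton-upper y k d k<d)) (ℤ.*-zeroʳ (+ (d !)))))) (ℤ.*-zeroʳ (coeff f k))

-- For F e = x ^ e this is x ^ e · h(x).
shifted : MonicPoly → (ℕ → ℤ) → ℕ → ℤ
shifted h F e = sumBelow (suc (deg h)) (λ k → coeff h k * F (e ℕ.+ k))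

-- A named copy of the function local to `sylvester`, specialised to the degree of `h`; the entries
-- agree by unfolding.
band : MonicPoly → ℕ → ℕ → ℤ
band h r c = if (r ≤ᵇ c) ∧ ((c ∸ r) ≤ᵇ deg h) then coeff h (deg h ∸ (c ∸ r)) else 0ℤ

≤⇒≤ᵇ≡true : ∀ {m n} → m ≤ n → (m ≤ᵇ n) ≡ true
≤⇒≤ᵇ≡true {m} {n} m≤n with m ≤ᵇ n | ℕ.≤⇒≤ᵇ m≤n
... | true | _ = refl

>⇒≤ᵇ≡false : ∀ {m n} → n < m → (m ≤ᵇ n) ≡ false
>⇒≤ᵇ≡false {m} {n} n<m with m ≤ᵇ n in eq
... | true = ⊥-elim (ℕ.<⇒≱ n<m (ℕ.≤ᵇ⇒≤ m n (subst T (sym eq) tt)))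
... | false = refl

band-left : ∀ h r c → c < r → band h r c ≡ 0ℤ
band-left h r c c<r rewrite >⇒≤ᵇ≡false c<r = refl

band-right : ∀ h r i → deg h < i → band h r (r ℕ.+ i) ≡ 0ℤ
band-right h r i d<i
  rewrite ≤⇒≤ᵇ≡true (ℕ.m≤m+n r i) | ℕ.m+n∸m≡n r i | >⇒≤ᵇ≡false d<i = refl

band-middle : ∀ h r i → i ≤ deg h → band h r (r ℕ.+ i) ≡ coeff h (deg h ∸ i)
band-middle h r i i≤d
  rewrite ≤⇒≤ᵇ≡true (ℕ.m≤m+n r i) | ℕ.m+n∸m≡n r i | ≤⇒≤ᵇ≡true i≤d = refl

-- Column j belongs to the power N - 1 - j. The r zeros to the left of the band cover the powers
-- above e₀ + deg h and the e₀ zeros to its right those below e₀, so the row represents x^e₀ h, and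
-- `F` replaces each power by an arbitrary value.
band-sum : ∀ h r e₀ N (F : ℕ → ℤ) → N ≡ e₀ ℕ.+ suc (deg h) ℕ.+ r →
  sumFin N (λ j → band h r (toℕ j) * F (N ∸ suc (toℕ j))) ≡ shifted h F e₀
band-sum h r e₀ N F refl = begin
  sumFin N (λ j → band h r (toℕ j) * F (N ∸ suc (toℕ j)))
    ≡⟨ sumFin-cong N (λ j → band h r (toℕ j) * F (N ∸ suc (toℕ j))) (λ j → G (N ∸ suc (toℕ j)))
         (λ j → cong (λ z → band h r z * F (N ∸ suc (toℕ j))) (sym (reverse-reverse (toℕ j) (toℕ<n j)))) ⟩
  sumFin N (λ j → G (N ∸ suc (toℕ j)))
    ≡⟨ sumFin-reverse N G ⟩
  sumBelow N G
    ≡⟨ sumBelow-split (e₀ ℕ.+ suc d) r G ⟩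
  sumBelow (e₀ ℕ.+ suc d) G + sumBelow r (λ i → G (e₀ ℕ.+ suc d ℕ.+ i))
    ≡⟨ cong₂ _+_ (sumBelow-split e₀ (suc d) G) (sumBelow-zero r (λ i → G (e₀ ℕ.+ suc d ℕ.+ i)) high) ⟩
  sumBelow e₀ G + sumBelow (suc d) (λ k → G (e₀ ℕ.+ k)) + 0ℤ
    ≡⟨ cong₂ (λ u v → u + v + 0ℤ) (sumBelow-zero e₀ G low)
         (sumBelow-cong (suc d) (λ k → G (e₀ ℕ.+ k)) (λ k → coeff h k * F (e₀ ℕ.+ k)) middle) ⟩
  0ℤ + shifted h F e₀ + 0ℤ
    ≡⟨ trans (ℤ.+-identityʳ (0ℤ + shifted h F e₀)) (ℤ.+-identityˡ (shifted h F e₀)) ⟩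
  shifted h F e₀ ∎
  where
  open ≡-Reasoning
  d = deg h
  G : ℕ → ℤ
  G e = band h r (N ∸ suc e) * F e
  reverse-reverse : ∀ j → j < N → N ∸ suc (N ∸ suc j) ≡ j
  reverse-reverse j j<N = trans (cong (_∸ suc (N ∸ suc j)) (sym (ℕ.m∸n+n≡m j<N)))
    (trans (cong (_∸ suc (N ∸ suc j)) (ℕ.+-suc (N ∸ suc j) j)) (ℕ.m+n∸m≡n (suc (N ∸ suc j)) j))
  kill : ∀ {b} e → b ≡ 0ℤ → b * F e ≡ 0ℤ
  kill e refl = ℤ.*-zeroˡ (F e)
  column : ∀ e c → N ≡ suc e ℕ.+ c → N ∸ suc e ≡ c
  column e c N≡ = trans (cong (_∸ suc e) N≡) (ℕ.m+n∸m≡n (suc e) c)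
  low : ∀ e → e < e₀ → G e ≡ 0ℤ
  low e e<e₀ = kill e (trans (cong (band h r) (column e (r ℕ.+ (suc d ℕ.+ o))
      (trans (cong (λ z → z ℕ.+ suc d ℕ.+ r) (sym (ℕ.m+[n∸m]≡n e<e₀))) (rearrange (suc e) o d r))))
    (band-right h r (suc d ℕ.+ o) (ℕ.m≤m+n (suc d) o)))
    where
    o = e₀ ∸ suc e
    rearrange : ∀ e o d r → e ℕ.+ o ℕ.+ suc d ℕ.+ r ≡ e ℕ.+ (r ℕ.+ (suc d ℕ.+ o))
    rearrange = solveₙ-∀
  middle : ∀ k → k < suc d → G (e₀ ℕ.+ k) ≡ coeff h k * F (e₀ ℕ.+ k)
  middle k (s≤s k≤d) = cong (_* F (e₀ ℕ.+ k)) (begin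
    band h r (N ∸ suc (e₀ ℕ.+ k))
      ≡⟨ cong (band h r) (column (e₀ ℕ.+ k) (r ℕ.+ (d ∸ k))
           (trans (cong (λ z → e₀ ℕ.+ suc z ℕ.+ r) (sym (ℕ.m+[n∸m]≡n k≤d))) (rearrange e₀ k (d ∸ k) r))) ⟩
    band h r (r ℕ.+ (d ∸ k))
      ≡⟨ band-middle h r (d ∸ k) (ℕ.m∸n≤m d k) ⟩
    coeff h (d ∸ (d ∸ k))
      ≡⟨ cong (coeff h) (ℕ.m∸[m∸n]≡n k≤d) ⟩
    coeff h k ∎)
    where
    rearrange : ∀ e k o r → e ℕ.+ suc (k ℕ.+ o) ℕ.+ r ≡ suc (e ℕ.+ k) ℕ.+ (r ℕ.+ o)
    rearrange = solveₙ-∀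
  high : ∀ i → i < r → G (e₀ ℕ.+ suc d ℕ.+ i) ≡ 0ℤ
  high i i<r = kill (e₀ ℕ.+ suc d ℕ.+ i) (trans
    (cong (band h r) (column (e₀ ℕ.+ suc d ℕ.+ i) o
      (trans (cong (e₀ ℕ.+ suc d ℕ.+_) (sym (ℕ.m+[n∸m]≡n i<r))) (rearrange (e₀ ℕ.+ suc d) i o))))
    (band-left h r o (ℕ.≤-trans (ℕ.m≤n+m (suc o) i)
      (ℕ.≤-reflexive (trans (ℕ.+-suc i o) (ℕ.m+[n∸m]≡n i<r))))))
    where
    o = r ∸ suc i
    rearrange : ∀ a i o → a ℕ.+ (suc i ℕ.+ o) ≡ suc (a ℕ.+ i) ℕ.+ o
    rearrange = solveₙ-∀

block : ∀ {A : Set} → ℕ → (ℕ → A) → (ℕ → A) → ℕ → A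
block m u v e = if e <ᵇ m then u e else v (e ∸ m)

block-left : ∀ {A : Set} m (u v : ℕ → A) e → e < m → block m u v e ≡ u e
block-left m u v e e<m rewrite ≤⇒≤ᵇ≡true e<m = refl

block-right : ∀ {A : Set} m (u v : ℕ → A) e → block m u v (m ℕ.+ e) ≡ v e
block-right m u v e rewrite >⇒≤ᵇ≡false (s≤s (ℕ.m≤m+n m e)) | ℕ.m+n∸m≡n m e = refl

-- Rows are indexed by e = N − 1 − i: the polynomial of row e is x^e g for e < deg f and x^(e − deg f) f otherwise.
sylvester-row : ∀ f g (F : ℕ → ℤ) (i : Fin (deg f ℕ.+ deg g)) →
  let N = deg f ℕ.+ deg g in
  sumFin N (λ j → sylvester f g i j * F (N ∸ suc (toℕ j)))
    ≡ block (deg f) (shifted g F) (shifted f F) (N ∸ suc (toℕ i))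
sylvester-row f g F i with toℕ i ℕ.<? deg g
... | yes i<n = begin
  sumFin N (λ j → sylvester f g i j * F (N ∸ suc (toℕ j)))
    ≡⟨ sumFin-cong N (λ j → sylvester f g i j * F (N ∸ suc (toℕ j))) (λ j → band f (toℕ i) (toℕ j) * F (N ∸ suc (toℕ j)))
         (λ j → cong (λ b → (if b then band f (toℕ i) (toℕ j) else band g (toℕ i ∸ n) (toℕ j)) * F (N ∸ suc (toℕ j)))
            (≤⇒≤ᵇ≡true i<n)) ⟩
  sumFin N (λ j → band f (toℕ i) (toℕ j) * F (N ∸ suc (toℕ j)))
    ≡⟨ band-sum f (toℕ i) o N F (trans (cong (m ℕ.+_) (sym n≡)) (rearrange m (toℕ i) o)) ⟩
  shifted f F o
    ≡⟨ block-right m (shifted g F) (shifted f F) o ⟨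
  block m (shifted g F) (shifted f F) (m ℕ.+ o)
    ≡⟨ cong (block m (shifted g F) (shifted f F)) (ℕ.+-∸-assoc m i<n) ⟨
  block m (shifted g F) (shifted f F) (N ∸ suc (toℕ i)) ∎
  where
  open ≡-Reasoning
  m = deg f
  n = deg g
  N = m ℕ.+ n
  o = n ∸ suc (toℕ i)
  n≡ : suc (toℕ i) ℕ.+ o ≡ n
  n≡ = ℕ.m+[n∸m]≡n i<n
  rearrange : ∀ m i o → m ℕ.+ (suc i ℕ.+ o) ≡ o ℕ.+ suc m ℕ.+ i
  rearrange = solveₙ-∀
... | no i≮n = begin
  sumFin N (λ j → sylvester f g i j * F (N ∸ suc (toℕ j)))
    ≡⟨ sumFin-cong N (λ j → sylvester f g i j * F (N ∸ suc (toℕ j))) (λ j → band g r (toℕ j) * F (N ∸ suc (toℕ j)))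
         (λ j → cong (λ b → (if b then band f (toℕ i) (toℕ j) else band g r (toℕ j)) * F (N ∸ suc (toℕ j)))
            (>⇒≤ᵇ≡false (s≤s (ℕ.≮⇒≥ i≮n)))) ⟩
  sumFin N (λ j → band g r (toℕ j) * F (N ∸ suc (toℕ j)))
    ≡⟨ band-sum g r e N F (trans (sym N≡) (rearrange n r e)) ⟩
  shifted g F e
    ≡⟨ block-left m (shifted g F) (shifted f F) e e<m ⟨
  block m (shifted g F) (shifted f F) e ∎
  where
  open ≡-Reasoning
  m = deg f
  n = deg g
  N = m ℕ.+ n
  r = toℕ i ∸ n
  e = N ∸ suc (toℕ i)
  N≡ : suc (n ℕ.+ r) ℕ.+ e ≡ N
  N≡ = trans (cong (λ z → suc z ℕ.+ e) (ℕ.m+[n∸m]≡n (ℕ.≮⇒≥ i≮n))) (ℕ.m+[n∸m]≡n (toℕ<n i))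
  rearrange : ∀ n r e → suc (n ℕ.+ r) ℕ.+ e ≡ e ℕ.+ suc n ℕ.+ r
  rearrange = solveₙ-∀
  e<m : e < m
  e<m = ℕ.+-cancelʳ-< n e m (ℕ.≤-trans (ℕ.m≤m+n (suc (e ℕ.+ n)) r)
    (ℕ.≤-reflexive (trans (rearrange′ e n r) N≡)))
    where
    rearrange′ : ∀ e n r → suc (e ℕ.+ n) ℕ.+ r ≡ suc (n ℕ.+ r) ℕ.+ e
    rearrange′ = solveₙ-∀

-- The transformed Sylvester matrix

-- Here `shifted` is the l-th Newton coefficient of x^e h at `y`; linearity carries `newton-Δ` from
-- powers to this polynomial.
shifted-Δ : ∀ h y l e → + (l !) * shifted h (λ j → newton y j l) e ≡ Δ l (λ x → x ℤ.^ e * eval h x) y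
shifted-Δ h y l e = begin
  + (l !) * shifted h (λ j → newton y j l) e
    ≡⟨ sumBelow-*ˡ n (+ (l !)) (λ k → coeff h k * newton y (e ℕ.+ k) l) ⟨
  sumBelow n (λ k → + (l !) * (coeff h k * newton y (e ℕ.+ k) l))
    ≡⟨ sumBelow-cong n (λ k → + (l !) * (coeff h k * newton y (e ℕ.+ k) l)) (λ k → coeff h k * Δ l (ℤ._^ (e ℕ.+ k)) y)
         (λ k _ → trans (pull (+ (l !)) (coeff h k) (newton y (e ℕ.+ k) l)) (cong (coeff h k *_) (newton-Δ y (e ℕ.+ k) l))) ⟩
  sumBelow n (λ k → coeff h k * Δ l (ℤ._^ (e ℕ.+ k)) y)
    ≡⟨ Δ-sum l n (coeff h) (λ k x → x ℤ.^ (e ℕ.+ k)) y ⟨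
  Δ l (λ x → sumBelow n (λ k → coeff h k * x ℤ.^ (e ℕ.+ k))) y
    ≡⟨ Δ-cong l (λ x → sumBelow n (λ k → coeff h k * x ℤ.^ (e ℕ.+ k))) (λ x → x ℤ.^ e * eval h x) factor y ⟩
  Δ l (λ x → x ℤ.^ e * eval h x) y ∎
  where
  open ≡-Reasoning
  n = suc (deg h)
  pull : ∀ a b c → a * (b * c) ≡ b * (a * c)
  pull = solve-∀
  factor : ∀ x → sumBelow n (λ k → coeff h k * x ℤ.^ (e ℕ.+ k)) ≡ x ℤ.^ e * eval h x
  factor x = begin
    sumBelow n (λ k → coeff h k * x ℤ.^ (e ℕ.+ k))
      ≡⟨ sumBelow-cong n (λ k → coeff h k * x ℤ.^ (e ℕ.+ k)) (λ k → x ℤ.^ e * (coeff h k * x ℤ.^ k))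
           (λ k _ → trans (cong (coeff h k *_) (ℤ.^-distribˡ-+-* x e k)) (pull (coeff h k) (x ℤ.^ e) (x ℤ.^ k))) ⟩
    sumBelow n (λ k → x ℤ.^ e * (coeff h k * x ℤ.^ k))
      ≡⟨ sumBelow-*ˡ n (x ℤ.^ e) (λ k → coeff h k * x ℤ.^ k) ⟩
    x ℤ.^ e * sumBelow n (λ k → coeff h k * x ℤ.^ k)
      ≡⟨ cong (x ℤ.^ e *_) (eval-sum h x) ⟨
    x ℤ.^ e * eval h x ∎

prodFin-cong : ∀ n (d e : Vector ℤ n) → (∀ i → d i ≡ e i) → prodFin n d ≡ prodFin n e
prodFin-cong zero d e eq = refl
prodFin-cong (suc n) d e eq = cong₂ _*_ (eq fzero) (prodFin-cong n (d ∘ fsuc) (e ∘ fsuc) (eq ∘ fsuc))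

prodFin-powers : ∀ p n (ε : ℕ → ℕ) → prodFin n (λ i → + (p ^ ε (n ∸ suc (toℕ i)))) ≡ + (p ^ sumBelowℕ n ε)
prodFin-powers p zero ε = refl
prodFin-powers p (suc n) ε = begin
  + (p ^ ε n) * prodFin n (λ i → + (p ^ ε (n ∸ suc (toℕ i))))
    ≡⟨ cong (+ (p ^ ε n) *_) (prodFin-powers p n ε) ⟩
  + (p ^ ε n) * + (p ^ sumBelowℕ n ε)
    ≡⟨ ℤ.pos-* (p ^ ε n) (p ^ sumBelowℕ n ε) ⟨
  + (p ^ ε n ℕ.* p ^ sumBelowℕ n ε)
    ≡⟨ cong +_ (trans (ℕ.*-comm (p ^ ε n) (p ^ sumBelowℕ n ε)) (sym (ℕ.^-distribˡ-+-* p (sumBelowℕ n ε) (ε n)))) ⟩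
  + (p ^ sumBelowℕ (suc n) ε) ∎
  where open ≡-Reasoning

prodFin-ones : ∀ n (d : Vector ℤ n) → (∀ i → d i ≡ 1ℤ) → prodFin n d ≡ 1ℤ
prodFin-ones zero d eq = refl
prodFin-ones (suc n) d eq = cong₂ _*_ (eq fzero) (prodFin-ones n (d ∘ fsuc) (eq ∘ fsuc))

<-split : ∀ m n κ → κ < m ℕ.+ n → κ < m ⊎ Σ[ d ∈ ℕ ] (d < n × κ ≡ m ℕ.+ d)
<-split m n κ κ<m+n with κ ℕ.<? m
... | yes κ<m = inj₁ κ<m
... | no κ≮m = inj₂ (κ ∸ m , ℕ.+-cancelˡ-< m (κ ∸ m) n (subst (_< m ℕ.+ n) (sym m+≡) κ<m+n) , sym m+≡)
  where m+≡ = ℕ.m+[n∸m]≡n (ℕ.≮⇒≥ κ≮m)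

module _ {p : ℕ} (pp : Prime p) where
  module Multiplier (t : ℕ) where
    multiplier : ℕ → ℤ → ℤ
    multiplier d x = + (p ^ (t ∸ α p d)) * falling d x

    multiplierCoeff : ℕ → ℕ → ℤ
    multiplierCoeff d k = + (p ^ (t ∸ α p d)) * fallingCoeff d k

    multiplier-∣ : ∀ d x → + (p ^ t) ∣ₛ multiplier d x
    multiplier-∣ d x = Signed.∣-trans
      (subst (+ (p ^ t) ∣ₛ_) (ℤ.pos-* (p ^ (t ∸ α p d)) (d !)) (Signed.∣ᵤ⇒∣
        -- Only an inequality of exponents holds here: when α(d) exceeds t the truncated difference
        -- is 0 and d! alone suffices.
        (ℕ∣.∣-trans (p^∣p^ pp (ℕ.≤-trans (ℕ.m≤n+m∸n t (α p d)) (ℕ.≤-reflexive (ℕ.+-comm (α p d) (t ∸ α p d)))))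
          (subst (_∣ₙ p ^ (t ∸ α p d) ℕ.* d !) (sym (ℕ.^-distribˡ-+-* p (t ∸ α p d) (α p d)))
            (ℕ∣.*-monoʳ-∣ (p ^ (t ∸ α p d)) (p^α∣! pp d))))))
      (Signed.*-monoʳ-∣ (+ (p ^ (t ∸ α p d))) (!∣falling d x))

    multiplierCoeff-upper : ∀ d k → d < k → multiplierCoeff d k ≡ 0ℤ
    multiplierCoeff-upper d k d<k =
      trans (cong (+ (p ^ (t ∸ α p d)) *_) (fallingCoeff-upper d k d<k)) (ℤ.*-zeroʳ (+ (p ^ (t ∸ α p d))))

    multiplierCoeff-diagonal : ∀ d → multiplierCoeff d d ≡ + (p ^ (t ∸ α p d))
    multiplierCoeff-diagonal d =
      trans (cong (+ (p ^ (t ∸ α p d)) *_) (fallingCoeff-diagonal d)) (ℤ.*-identityʳ (+ (p ^ (t ∸ α p d))))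

    multiplier-Δ : ∀ h y l d n → d < n →
      + (l !) * sumBelow n (λ e → multiplierCoeff d e * shifted h (λ j → newton y j l) e)
        ≡ Δ l (λ x → multiplier d x * eval h x) y
    multiplier-Δ h y l d n d<n = begin
      + (l !) * sumBelow n (λ e → c e * s e)
        ≡⟨ sumBelow-*ˡ n (+ (l !)) (λ e → c e * s e) ⟨
      sumBelow n (λ e → + (l !) * (c e * s e))
        ≡⟨ sumBelow-cong n (λ e → + (l !) * (c e * s e)) (λ e → c e * Δ l (λ x → x ℤ.^ e * eval h x) y)
             (λ e _ → trans (pull (+ (l !)) (c e) (s e)) (cong (c e *_) (shifted-Δ h y l e))) ⟩
      sumBelow n (λ e → c e * Δ l (λ x → x ℤ.^ e * eval h x) y)
        ≡⟨ Δ-sum l n c (λ e x → x ℤ.^ e * eval h x) y ⟨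
      Δ l (λ x → sumBelow n (λ e → c e * (x ℤ.^ e * eval h x))) y
        ≡⟨ Δ-cong l (λ x → sumBelow n (λ e → c e * (x ℤ.^ e * eval h x))) (λ x → multiplier d x * eval h x) factor y ⟩
      Δ l (λ x → multiplier d x * eval h x) y ∎
      where
      open ≡-Reasoning
      c = multiplierCoeff d
      s = shifted h (λ j → newton y j l)
      q = + (p ^ (t ∸ α p d))
      pull : ∀ a b c → a * (b * c) ≡ b * (a * c)
      pull = solve-∀
      regroup : ∀ q c x v → q * c * (x * v) ≡ q * v * (c * x)
      regroup = solve-∀
      regroup′ : ∀ q v f → q * v * f ≡ q * f * v
      regroup′ = solve-∀
      factor : ∀ x → sumBelow n (λ e → c e * (x ℤ.^ e * eval h x)) ≡ multiplier d x * eval h x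
      factor x = begin
        sumBelow n (λ e → c e * (x ℤ.^ e * eval h x))
          ≡⟨ sumBelow-cong n (λ e → c e * (x ℤ.^ e * eval h x)) (λ e → q * eval h x * (fallingCoeff d e * x ℤ.^ e))
               (λ e _ → regroup q (fallingCoeff d e) (x ℤ.^ e) (eval h x)) ⟩
        sumBelow n (λ e → q * eval h x * (fallingCoeff d e * x ℤ.^ e))
          ≡⟨ sumBelow-*ˡ n (q * eval h x) (λ e → fallingCoeff d e * x ℤ.^ e) ⟩
        q * eval h x * sumBelow n (λ e → fallingCoeff d e * x ℤ.^ e)
          ≡⟨ cong (q * eval h x *_) (falling-sum d n x d<n) ⟩
        q * eval h x * falling d x
          ≡⟨ regroup′ q (eval h x) (falling d x) ⟩
        multiplier d x * eval h x ∎

    -- Block diagonal: index κ < m forms u_κ g from the rows x^e g, and index m + d forms u_d f from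
    -- the rows x^e f. In the first case the second block needs no explicit zeros, because u_κ has
    -- degree κ < m.
    rowCoeff : ℕ → ℕ → ℕ → ℤ
    rowCoeff m = block m multiplierCoeff λ d → block m (λ _ → 0ℤ) (multiplierCoeff d)

    rowExponent : ℕ → ℕ → ℕ
    rowExponent m = block m (λ d → t ∸ α p d) (λ d → t ∸ α p d)

    rowCoeff-left : ∀ m κ → κ < m → ∀ e → rowCoeff m κ e ≡ multiplierCoeff κ e
    rowCoeff-left m κ κ<m e =
      cong (λ r → r e) (block-left m multiplierCoeff (λ d → block m (λ _ → 0ℤ) (multiplierCoeff d)) κ κ<m)

    rowCoeff-right : ∀ m d e → rowCoeff m (m ℕ.+ d) e ≡ block m (λ _ → 0ℤ) (multiplierCoeff d) e
    rowCoeff-right m d e = cong (λ r → r e) (block-right m multiplierCoeff (λ d → block m (λ _ → 0ℤ) (multiplierCoeff d)) d)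

    rowCoeff-upper : ∀ m n κ e → κ < m ℕ.+ n → e < m ℕ.+ n → κ < e → rowCoeff m κ e ≡ 0ℤ
    rowCoeff-upper m n κ e κ<N e<N κ<e with <-split m n κ κ<N
    ... | inj₁ κ<m = trans (rowCoeff-left m κ κ<m e) (multiplierCoeff-upper κ e κ<e)
    ... | inj₂ (d , d<n , refl) with <-split m n e e<N
    ...   | inj₁ e<m = ⊥-elim (ℕ.<⇒≱ (ℕ.<-trans κ<e e<m) (ℕ.m≤m+n m d))
    ...   | inj₂ (k , k<n , refl) = trans (rowCoeff-right m d (m ℕ.+ k))
      (trans (block-right m (λ _ → 0ℤ) (multiplierCoeff d) k) (multiplierCoeff-upper d k (ℕ.+-cancelˡ-< m d k κ<e)))

    rowCoeff-diagonal : ∀ m n κ → κ < m ℕ.+ n → rowCoeff m κ κ ≡ + (p ^ rowExponent m κ)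
    rowCoeff-diagonal m n κ κ<N with <-split m n κ κ<N
    ... | inj₁ κ<m = trans (rowCoeff-left m κ κ<m κ) (trans (multiplierCoeff-diagonal κ)
      (cong (λ z → + (p ^ z)) (sym (block-left m (λ d → t ∸ α p d) (λ d → t ∸ α p d) κ κ<m))))
    ... | inj₂ (d , d<n , refl) = trans (rowCoeff-right m d (m ℕ.+ d))
      (trans (block-right m (λ _ → 0ℤ) (multiplierCoeff d) d) (trans (multiplierCoeff-diagonal d)
        (cong (λ z → + (p ^ z)) (sym (block-right m (λ d → t ∸ α p d) (λ d → t ∸ α p d) d)))))

    rowExponent-sum : ∀ m n → sumBelowℕ (m ℕ.+ n) (rowExponent m) ≤ B p t ℕ.+ B p t
    rowExponent-sum m n = ℕ.≤-trans
      (ℕ.≤-reflexive (trans (sumBelowℕ-split m n (rowExponent m)) (cong₂ ℕ._+_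
        (sumBelowℕ-cong m (rowExponent m) δ λ κ κ<m → block-left m δ δ κ κ<m)
        (sumBelowℕ-cong n (λ d → rowExponent m (m ℕ.+ d)) δ λ d _ → block-right m δ δ d))))
      (ℕ.+-mono-≤ (deficit-≤ pp t m) (deficit-≤ pp t n))
      where
      δ : ℕ → ℕ
      δ d = t ∸ α p d

    -- The value of d is left unspecified because the power of p dividing a column is the same for
    -- all rows.
    rowSum : ∀ m n (u v : ℕ → ℤ) κ → κ < m ℕ.+ n →
      (Σ[ d ∈ ℕ ] (d < m × sumBelow (m ℕ.+ n) (λ e → rowCoeff m κ e * block m u v e)
        ≡ sumBelow m (λ e → multiplierCoeff d e * u e)))
      ⊎ (Σ[ d ∈ ℕ ] (d < n × sumBelow (m ℕ.+ n) (λ e → rowCoeff m κ e * block m u v e)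
        ≡ sumBelow n (λ e → multiplierCoeff d e * v e)))
    rowSum m n u v κ κ<N with <-split m n κ κ<N
    ... | inj₁ κ<m = inj₁ (κ , κ<m , trans (sumBelow-split m n G) (trans
      (cong₂ _+_
        (sumBelow-cong m G (λ e → multiplierCoeff κ e * u e) λ e e<m →
          cong₂ _*_ (rowCoeff-left m κ κ<m e) (block-left m u v e e<m))
        (sumBelow-zero n (λ e → G (m ℕ.+ e)) λ e _ →
          trans (cong (_* block m u v (m ℕ.+ e)) (trans (rowCoeff-left m κ κ<m (m ℕ.+ e))
            (multiplierCoeff-upper κ (m ℕ.+ e) (ℕ.<-≤-trans κ<m (ℕ.m≤m+n m e))))) (ℤ.*-zeroˡ (block m u v (m ℕ.+ e)))))
      (ℤ.+-identityʳ (sumBelow m (λ e → multiplierCoeff κ e * u e)))))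
      where
      G : ℕ → ℤ
      G e = rowCoeff m κ e * block m u v e
    ... | inj₂ (d , d<n , refl) = inj₂ (d , d<n , trans (sumBelow-split m n G) (trans
      (cong₂ _+_
        (sumBelow-zero m G λ e e<m →
          trans (cong (_* block m u v e) (trans (rowCoeff-right m d e) (block-left m (λ _ → 0ℤ) (multiplierCoeff d) e e<m)))
            (ℤ.*-zeroˡ (block m u v e)))
        (sumBelow-cong n (λ e → G (m ℕ.+ e)) (λ e → multiplierCoeff d e * v e) λ e _ →
          cong₂ _*_ (trans (rowCoeff-right m d (m ℕ.+ e)) (block-right m (λ _ → 0ℤ) (multiplierCoeff d) e))
            (block-right m u v e)))
      (ℤ.+-identityˡ (sumBelow n (λ e → multiplierCoeff d e * v e)))))
      where
      G : ℕ → ℤ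
      G e = rowCoeff m (m ℕ.+ d) e * block m u v e

powers-∣ : ∀ p a b {x y} → + (p ^ a) ∣ₛ x → + (p ^ b) ∣ₛ y → + (p ^ (b ℕ.+ a)) ∣ₛ x * y
powers-∣ p a b a∣x b∣y = subst (_∣ₛ _) (begin
  + (p ^ a) * + (p ^ b)        ≡⟨ ℤ.pos-* (p ^ a) (p ^ b) ⟨
  + (p ^ a ℕ.* p ^ b)          ≡⟨ cong +_ (ℕ.^-distribˡ-+-* p a b) ⟨
  + (p ^ (a ℕ.+ b))            ≡⟨ cong (λ z → + (p ^ z)) (ℕ.+-comm a b) ⟩
  + (p ^ (b ℕ.+ a))            ∎) (*-pres-∣ₛ a∣x b∣y)
  where open ≡-Reasoning

-- Divisibility of the resultant and comparison of exponents

module _ {p : ℕ} (pp : Prime p) where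
  p^∣values⇒≤α : ∀ f q → (∀ x → + (p ^ q) ∣ₛ eval f x) → q ≤ α p (deg f)
  p^∣values⇒≤α f q div = p^∣!⇒≤α pp q (deg f)
    (Signed.∣⇒∣ᵤ (subst (+ (p ^ q) ∣ₛ_) (Δ-deg f 0ℤ) (Δ-∣ (deg f) (+ (p ^ q)) (eval f) div 0ℤ)))

  module _ (f g : MonicPoly) (s t S : ℕ) (y : ℤ)
           (s∣f : ∀ x → + (p ^ s) ∣ₛ eval f x) (s∣g : ∀ x → + (p ^ s) ∣ₛ eval g x)
           (S∣f : + (p ^ S) ∣ₛ eval f y) (S∣g : + (p ^ S) ∣ₛ eval g y) where
    open Multiplier pp t
    private
      m = deg f
      n = deg g
      N = m ℕ.+ n

    columnExponent : ℕ → ℕ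
    columnExponent zero = S ℕ.+ t
    columnExponent (suc l) = s ℕ.+ t ∸ α p (suc l)

    -- For l = 0 the entry is the value u_d(y) h(y), with p^t in the first factor and p^S in the
    -- second. For l > 0, l! times the entry is a difference of u_d h, and `factorial-cancel`
    -- removes l!.
    column-∣ : ∀ h → (∀ x → + (p ^ s) ∣ₛ eval h x) → + (p ^ S) ∣ₛ eval h y → ∀ l d k → d < k →
      + (p ^ columnExponent l) ∣ₛ sumBelow k (λ e → multiplierCoeff d e * shifted h (λ j → newton y j l) e)
    column-∣ h s∣h S∣h zero d k d<k = subst (+ (p ^ (S ℕ.+ t)) ∣ₛ_)
      (trans (sym (multiplier-Δ h y 0 d k d<k))
        (ℤ.*-identityˡ (sumBelow k (λ e → multiplierCoeff d e * shifted h (λ j → newton y j 0) e))))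
      (powers-∣ p t S (multiplier-∣ d y) S∣h)
    column-∣ h s∣h S∣h (suc l) d k d<k = Signed.∣ᵤ⇒∣ (factorial-cancel pp (s ℕ.+ t) (suc l) ℤ.∣ X ∣
      (subst (p ^ (s ℕ.+ t) ∣ₙ_) (ℤ.abs-* (+ (suc l !)) X) (Signed.∣⇒∣ᵤ
        (subst (+ (p ^ (s ℕ.+ t)) ∣ₛ_) (sym (multiplier-Δ h y (suc l) d k d<k))
          (Δ-∣ (suc l) (+ (p ^ (s ℕ.+ t))) (λ x → multiplier d x * eval h x)
            (λ x → powers-∣ p t s (multiplier-∣ d x) (s∣h x)) y)))))
      where
      X = sumBelow k (λ e → multiplierCoeff d e * shifted h (λ j → newton y j (suc l)) e)

    -- Index i stands for the power N - 1 - i, as in the Sylvester matrix. This reversal makes the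
    -- lower triangular arrays `rowCoeff` and `newton` upper triangular matrices.
    rows : Matrix N N
    rows i k = rowCoeff m (N ∸ suc (toℕ i)) (N ∸ suc (toℕ k))

    columns : Matrix N N
    columns j l = newton y (N ∸ suc (toℕ j)) (N ∸ suc (toℕ l))

    reverse-< : ∀ (i : Fin N) → N ∸ suc (toℕ i) < N
    reverse-< i = ℕ.∸-monoʳ-< (s≤s z≤n) (toℕ<n i)

    reverse-mono : ∀ (i j : Fin N) → toℕ j < toℕ i → N ∸ suc (toℕ i) < N ∸ suc (toℕ j)
    reverse-mono i j j<i = ℕ.∸-monoʳ-< (s≤s j<i) (toℕ<n i)

    det-rows : det N rows ≡ + (p ^ sumBelowℕ N (rowExponent m))
    det-rows = trans
      (det-upperTriangular N rows λ i j j<i →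
        rowCoeff-upper m n (N ∸ suc (toℕ i)) (N ∸ suc (toℕ j)) (reverse-< i) (reverse-< j) (reverse-mono i j j<i))
      (trans (prodFin-cong N (λ i → rows i i) (λ i → + (p ^ rowExponent m (N ∸ suc (toℕ i))))
          λ i → rowCoeff-diagonal m n (N ∸ suc (toℕ i)) (reverse-< i))
        (prodFin-powers p N (rowExponent m)))

    det-columns : det N columns ≡ 1ℤ
    det-columns = trans
      (det-upperTriangular N columns λ i j j<i → newton-upper y (N ∸ suc (toℕ i)) (N ∸ suc (toℕ j)) (reverse-mono i j j<i))
      (prodFin-ones N (λ i → columns i i) λ i → newton-diagonal y (N ∸ suc (toℕ i)))

    product : Matrix N N
    product = rows ⊗ (sylvester f g ⊗ columns)

    det-product : det N product ≡ + (p ^ sumBelowℕ N (rowExponent m)) * resultant f g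
    det-product = trans (det-⊗ N rows (sylvester f g ⊗ columns)) (cong₂ _*_ det-rows
      (trans (det-⊗ N (sylvester f g) columns)
        (trans (cong (resultant f g *_) det-columns) (ℤ.*-identityʳ (resultant f g)))))

    product-entry : ∀ i l → let F = λ j → newton y j (N ∸ suc (toℕ l)) in
      product i l ≡ sumBelow N (λ e → rowCoeff m (N ∸ suc (toℕ i)) e * block m (shifted g F) (shifted f F) e)
    product-entry i l = trans
      (sumFin-cong N (λ k → rows i k * (sylvester f g ⊗ columns) k l) (λ k → G (N ∸ suc (toℕ k)))
        λ k → cong (rows i k *_) (sylvester-row f g F k))
      (sumFin-reverse N G)
      where
      F : ℕ → ℤ
      F j = newton y j (N ∸ suc (toℕ l))
      G : ℕ → ℤ
      G e = rowCoeff m (N ∸ suc (toℕ i)) e * block m (shifted g F) (shifted f F) e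

    product-∣ : ∀ i l → + (p ^ columnExponent (N ∸ suc (toℕ l))) ∣ₛ product i l
    product-∣ i l with rowSum m n (shifted g (λ j → newton y j (N ∸ suc (toℕ l))))
                         (shifted f (λ j → newton y j (N ∸ suc (toℕ l))))
                         (N ∸ suc (toℕ i)) (reverse-< i)
    ... | inj₁ (d , d<m , eq) = subst (+ (p ^ columnExponent (N ∸ suc (toℕ l))) ∣ₛ_) (sym (trans (product-entry i l) eq))
      (column-∣ g s∣g S∣g (N ∸ suc (toℕ l)) d m d<m)
    ... | inj₂ (d , d<n , eq) = subst (+ (p ^ columnExponent (N ∸ suc (toℕ l))) ∣ₛ_) (sym (trans (product-entry i l) eq))
      (column-∣ f s∣f S∣f (N ∸ suc (toℕ l)) d n d<n)

    resultant-∣ : + (p ^ sumBelowℕ N columnExponent) ∣ₛ + (p ^ sumBelowℕ N (rowExponent m)) * resultant f g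
    resultant-∣ = subst₂ _∣ₛ_ (prodFin-powers p N columnExponent) det-product
      (prodFin-∣-det N (λ l → + (p ^ columnExponent (N ∸ suc (toℕ l)))) product product-∣)

    -- Only column 0 differs, having S + t where α(0) = 0 would give s + t. Adding s on one side and
    -- S on the other avoids subtraction.
    columnExponent-sum : ∀ k → sumBelowℕ (suc k) columnExponent ℕ.+ s ≡ sumBelowℕ (suc k) (λ l → s ℕ.+ t ∸ α p l) ℕ.+ S
    columnExponent-sum zero = rearrange S t s
      where
      rearrange : ∀ S t s → S ℕ.+ t ℕ.+ s ≡ s ℕ.+ t ℕ.+ S
      rearrange = solveₙ-∀
    columnExponent-sum (suc k) = trans (rearrange (sumBelowℕ (suc k) columnExponent) δ s)
      (trans (cong (ℕ._+ δ) (columnExponent-sum k)) (rearrange (sumBelowℕ (suc k) (λ l → s ℕ.+ t ∸ α p l)) S δ))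
      where
      δ = s ℕ.+ t ∸ α p (suc k)
      rearrange : ∀ a b c → a ℕ.+ b ℕ.+ c ≡ a ℕ.+ c ℕ.+ b
      rearrange = solveₙ-∀

    valuation-bound : ∀ V → ¬ (+ (p ^ suc V) ∣ resultant f g) → β p (s ℕ.+ t) ≤ N → 0 < N →
      B p (s ℕ.+ t) ℕ.+ S ≤ B p t ℕ.+ B p t ℕ.+ V ℕ.+ s
    valuation-bound V V<∤ β≤N 0<N = begin
      B p (s ℕ.+ t) ℕ.+ S
        ≡⟨ cong (ℕ._+ S) (deficit-≡ pp (s ℕ.+ t) N β≤N) ⟨
      sumBelowℕ N (λ l → s ℕ.+ t ∸ α p l) ℕ.+ S
        ≡⟨ nonempty N 0<N ⟨
      sumBelowℕ N columnExponent ℕ.+ s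
        -- If the column exponents added up to more than E + V, then p^(E+V+1) would divide p^E r,
        -- and p^(V+1) would divide r.
        ≤⟨ ℕ.+-monoˡ-≤ s (ℕ.≮⇒≥ λ lt → V<∤ (ℕ∣.*-cancelˡ-∣ (p ^ E) {{p^_≢0 pp E}}
             (subst₂ _∣ₙ_ (ℕ.^-distribˡ-+-* p E (suc V)) (ℤ.abs-* (+ (p ^ E)) (resultant f g))
               (ℕ∣.∣-trans (p^∣p^ pp (ℕ.≤-trans (ℕ.≤-reflexive (ℕ.+-suc E V)) lt)) (Signed.∣⇒∣ᵤ resultant-∣))))) ⟩
      E ℕ.+ V ℕ.+ s
        ≤⟨ ℕ.+-monoˡ-≤ s (ℕ.+-monoˡ-≤ V (rowExponent-sum m n)) ⟩
      B p t ℕ.+ B p t ℕ.+ V ℕ.+ s ∎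
      where
      open ℕ.≤-Reasoning
      E = sumBelowℕ N (rowExponent m)
      nonempty : ∀ k → 0 < k → sumBelowℕ k columnExponent ℕ.+ s ≡ sumBelowℕ k (λ l → s ℕ.+ t ∸ α p l) ℕ.+ S
      nonempty (suc k) _ = columnExponent-sum k

  module _ (f g : MonicPoly) (s S V : ℕ) (y : ℤ)
           (s∣f : ∀ x → + (p ^ s) ∣ₛ eval f x) (s∣g : ∀ x → + (p ^ s) ∣ₛ eval g x)
           (S∣f : + (p ^ S) ∣ₛ eval f y) (S∣g : + (p ^ S) ∣ₛ eval g y)
           (V<∤ : ¬ (+ (p ^ suc V) ∣ resultant f g)) where

    bound-small : ∀ t → t ≤ s → B p (s ℕ.+ t) ℕ.+ S ≤ B p t ℕ.+ B p t ℕ.+ V ℕ.+ s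
    bound-small t t≤s with 0 ℕ.<? deg f ℕ.+ deg g
    ... | yes 0<N = valuation-bound f g s t S y s∣f s∣g S∣f S∣g V V<∤ β≤N 0<N
      where
      β≤N : β p (s ℕ.+ t) ≤ deg f ℕ.+ deg g
      -- s + t ≤ 2s ≤ α(deg f) + α(deg g) ≤ α(deg f + deg g).
      β≤N = ≤α⇒β≤ pp (ℕ.≤-trans (ℕ.+-monoʳ-≤ s t≤s)
        (ℕ.≤-trans (ℕ.+-mono-≤ (p^∣values⇒≤α f s s∣f) (p^∣values⇒≤α g s s∣g)) (α-superadditive pp (deg f) (deg g))))
    -- Without a column 0 there is nothing to gain from `y`. But then f = 1, which forces s = S = 0
    -- and with t ≤ s also t = 0.
    ... | no N≯0 = subst₂ (λ s S → B p (s ℕ.+ t) ℕ.+ S ≤ B p t ℕ.+ B p t ℕ.+ V ℕ.+ s) (sym s≡0) (sym S≡0)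
      (subst (λ t → B p t ℕ.+ 0 ≤ B p t ℕ.+ B p t ℕ.+ V ℕ.+ 0) (sym (ℕ.n≤0⇒n≡0 (subst (t ≤_) s≡0 t≤s))) z≤n)
      where
      deg≡0 : deg f ≡ 0
      deg≡0 = ℕ.m+n≡0⇒m≡0 (deg f) (ℕ.n≤0⇒n≡0 (ℕ.≮⇒≥ N≯0))
      s≡0 : s ≡ 0
      s≡0 = ℕ.n≤0⇒n≡0 (subst (λ d → s ≤ α p d) deg≡0 (p^∣values⇒≤α f s s∣f))
      S≡0 : S ≡ 0
      S≡0 = p^∣1⇒≡0 pp S (Signed.∣⇒∣ᵤ (subst (+ (p ^ S) ∣ₛ_) (subst (λ d → Δ d (eval f) y ≡ + (d !)) deg≡0 (Δ-deg f y)) S∣f))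

    -- From t to t + 1 the left side grows by β(s + t + 1) ≤ β(2(t + 1)) ≤ 2 β(t + 1) as soon as t ≥ s.
    bound-large : ∀ d → B p (s ℕ.+ (s ℕ.+ d)) ℕ.+ S ≤ B p (s ℕ.+ d) ℕ.+ B p (s ℕ.+ d) ℕ.+ V ℕ.+ s
    bound-large zero = bound-small (s ℕ.+ 0) (ℕ.≤-reflexive (ℕ.+-identityʳ s))
    bound-large (suc d) = begin
      B p (s ℕ.+ (s ℕ.+ suc d)) ℕ.+ S
        ≡⟨ cong (λ z → B p z ℕ.+ S) (trans (cong (s ℕ.+_) (ℕ.+-suc s d)) (ℕ.+-suc s (s ℕ.+ d))) ⟩
      B p (s ℕ.+ (s ℕ.+ d)) ℕ.+ β p (suc (s ℕ.+ (s ℕ.+ d))) ℕ.+ S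
        ≡⟨ rearrange (B p (s ℕ.+ (s ℕ.+ d))) (β p (suc (s ℕ.+ (s ℕ.+ d)))) S ⟩
      B p (s ℕ.+ (s ℕ.+ d)) ℕ.+ S ℕ.+ β p (suc (s ℕ.+ (s ℕ.+ d)))
        ≤⟨ ℕ.+-mono-≤ (bound-large d) (ℕ.≤-trans (β-mono pp 1+s+t≤) (β-subadditive pp (suc (s ℕ.+ d)) (suc (s ℕ.+ d)))) ⟩
      B p (s ℕ.+ d) ℕ.+ B p (s ℕ.+ d) ℕ.+ V ℕ.+ s ℕ.+ (b ℕ.+ b)
        ≡⟨ rearrange′ (B p (s ℕ.+ d)) b V s ⟩
      B p (suc (s ℕ.+ d)) ℕ.+ B p (suc (s ℕ.+ d)) ℕ.+ V ℕ.+ s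
        ≡⟨ cong (λ z → B p z ℕ.+ B p z ℕ.+ V ℕ.+ s) (ℕ.+-suc s d) ⟨
      B p (s ℕ.+ suc d) ℕ.+ B p (s ℕ.+ suc d) ℕ.+ V ℕ.+ s ∎
      where
      open ℕ.≤-Reasoning
      b = β p (suc (s ℕ.+ d))
      rearrange : ∀ a b c → a ℕ.+ b ℕ.+ c ≡ a ℕ.+ c ℕ.+ b
      rearrange = solveₙ-∀
      rearrange′ : ∀ a b v s → a ℕ.+ a ℕ.+ v ℕ.+ s ℕ.+ (b ℕ.+ b) ≡ a ℕ.+ b ℕ.+ (a ℕ.+ b) ℕ.+ v ℕ.+ s
      rearrange′ = solveₙ-∀
      1+s+t≤ : suc (s ℕ.+ (s ℕ.+ d)) ≤ suc (s ℕ.+ d) ℕ.+ suc (s ℕ.+ d)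
      1+s+t≤ = ℕ.+-mono-≤ (s≤s (ℕ.m≤m+n s d)) (ℕ.n≤1+n (s ℕ.+ d))

    bound : ∀ t → B p (s ℕ.+ t) ℕ.+ S ≤ B p t ℕ.+ B p t ℕ.+ V ℕ.+ s
    bound t with ℕ.≤-total t s
    ... | inj₁ t≤s = bound-small t t≤s
    ... | inj₂ s≤t = subst (λ z → B p (s ℕ.+ z) ℕ.+ S ≤ B p z ℕ.+ B p z ℕ.+ V ℕ.+ s) (ℕ.m+[n∸m]≡n s≤t) (bound-large (t ∸ s))

-- The bound was kept subtraction-free in ℕ; the differences in ℤ are formed only here.
≤⇒difference≥ : ∀ V S X b s → X ℕ.+ S ≤ b ℕ.+ b ℕ.+ V ℕ.+ s → + V - + S ≥ + X - + 2 * + b - + s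
≤⇒difference≥ V S X b s le = ℤ.0≤i-j⇒j≤i (subst (0ℤ ℤ.≤_)
  (trans (cong₂ _-_ (trans (ℤ.pos-+ (b ℕ.+ b ℕ.+ V) s)
        (cong (_+ + s) (trans (ℤ.pos-+ (b ℕ.+ b) V) (cong (_+ + V) (ℤ.pos-+ b b)))))
      (ℤ.pos-+ X S))
    (rearrange (+ b) (+ V) (+ s) (+ X) (+ S)))
  (ℤ.i≤j⇒0≤j-i (ℤ.+≤+ le)))
  where
  rearrange : ∀ b V s X S → (b + b + V + s) - (X + S) ≡ (V - S) - (X - + 2 * b - s)
  rearrange = solve-∀

theorem3 : (p : ℕ) → Prime p → (f g : MonicPoly) → resultant f g ≢ 0ℤ →
    (s : ℕ) → (∀ (n : ℤ) → (+ (p ^ s) ∣ eval f n) × (+ (p ^ s) ∣ eval g n)) →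
    (S : ℕ) → (∃ λ (n : ℤ) → HasVal p (gcd (eval f n) (eval g n)) S) →
    (∀ (n : ℤ) (k : ℕ) → + (p ^ k) ∣ gcd (eval f n) (eval g n) → k ≤ S) →
    (V : ℕ) → HasVal p (resultant f g) V →
    (t : ℕ) → + V - + S ≥ + B p (s +ℕ t) - + 2 * + B p t - + s
theorem3 p pp f g _ s s∣fg S (y , S∣gcd , _) _ V (_ , V<∤) t =
  ≤⇒difference≥ V S (B p (s +ℕ t)) (B p t) s (bound pp f g s S V y
    (λ x → Signed.∣ᵤ⇒∣ (proj₁ (s∣fg x))) (λ x → Signed.∣ᵤ⇒∣ (proj₂ (s∣fg x)))
    (Signed.∣ᵤ⇒∣ (ℕ∣.∣-trans S∣gcd (gcd[i,j]∣i (eval f y) (eval g y))))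
    (Signed.∣ᵤ⇒∣ (ℕ∣.∣-trans S∣gcd (gcd[i,j]∣j (eval f y) (eval g y)))) V<∤ t)
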